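{- The arithmetical theory $R^\backsim$ is essentially undecidable in the first-order logic $\mathrm{QL}_0$; that is, $R^\backsim$ is $\Sigma_1$-consistent in $\mathrm{QL}_0$, and every theory $T$ (in the arithmetical language) that is $\Sigma_1$-consistent in $\mathrm{QL}_0$ and strengthens $R^\backsim$ in $\mathrm{QL}_0$ is undecidable in $\mathrm{QL}_0$.
   Context: Propositional logic $\mathrm{L}_0$: the language has binary connectives $\to,\wedge,\vee$ and a constant $\bot$; $\neg\varphi:=\varphi\to\bot$ and $\varphi\leftrightarrow\psi:=(\varphi\to\psi)\wedge(\psi\to\varphi)$. $\mathrm{L}_0$ is given by the Hilbert system with axioms $\varphi\to\varphi$; $\varphi\wedge\psi\to\varphi$; $\varphi\wedge\psi\to\psi$; $\varphi\to\varphi\vee\psi$; $\psi\to\varphi\vee\psi$; and rules (premises $\rhd$ conclusion): $\varphi\rhd\psi\to\varphi$; $\varphi,\varphi\to\psi\rhd\psi$; $\varphi\rhd(\varphi\to\psi)\to\psi$; $\varphi\to\psi,\psi\to\chi\rhd\varphi\to\chi$; $\neg\varphi\vee\neg\psi\rhd\neg(\varphi\wedge\psi)$; $\chi\to\varphi,\chi\to\psi\rhd\chi\to\varphi\wedge\psi$; $\varphi\to\chi,\psi\to\chi\rhd\varphi\vee\psi\to\chi$. (No axiom $\bot\to\varphi$.) First-order logic $\mathrm{QL}_0$: over a first-order language with equality $=$ (write $t\neq s$ for $\neg(t=s)$), axiomatised by all substitution instances (atoms replaced by first-order formulas) of the axioms and rules of $\mathrm{L}_0$ together with: $(\forall x)\varphi(x)\to\varphi(t)$;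 $\varphi(t)\to(\exists x)\varphi(x)$; $\chi\to\psi\rhd\chi\to(\forall x)\psi$; $\psi\to\chi\rhd(\exists x)\psi\to\chi$ (for $t$ substitutable for $x$ and $x$ not free in $\chi$); $x=x$; $x=y\to y=x$; $x=y\to(y=z\to x=z)$; $x=y\to t(x)=t(y)$; $x=y\to(\varphi(x)\to\varphi(y))$. Arithmetical language: constant $\overline{0}$, unary function $S$, binary predicates $=$ and $\leq$, ternary predicates $A$ and $M$. Numerals: $\overline{n}=S\cdots S(\overline{0})$ ($n$ times $S$). Bounded quantifiers: $(\forall x\leq y)\varphi:=(\forall x)(\neg(x\leq y)\vee\varphi)$, $(\exists x\leq y)\varphi:=(\exists x)(x\leq y\wedge\varphi)$. $\Delta_0$-formulas are those all of whose quantifiers are bounded; $\Sigma_1$-formulas are those of the form $(\exists x)\psi$ with $\psi$ a $\Delta_0$-formula; the negation of a $\Sigma_1$-formula $\varphi$ is $\neg\varphi$. $R^\backsim$ is the theory with axioms: $A(\overline{m},\overline{n},x)\leftrightarrow\overline{m+n}=x$ and $M(\overline{m},\overline{n},x)\leftrightarrow\overline{m\cdot n}=x$ for all $m,n$; $\overline{m}\neq\overline{n}$ for $m\neq n$; $x\leq\overline{n}\leftrightarrow(x=\overline{0}\vee x=\overline{1}\vee\dots\vee x=\overline{n})$, $x\leq\overline{n}\vee\overline{n}\leq x$, and $x\leq\overline{n}\vee\neg(x\leq\overline{n})$ for all $n$. Abstract notions for a logic $\mathfrak{L}$ (consequence relation $\vdash_\mathfrak{L}$): $C_\mathfrak{L}(T)=\{\varphi\mid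 T\vdash_\mathfrak{L}\varphi\}$; $T$ is decidable in $\mathfrak{L}$ if $C_\mathfrak{L}(T)$ is recursive (w.r.t. a standard coding of formulas); $T$ strengthens $S$ in $\mathfrak{L}$ if $S\subseteq C_\mathfrak{L}(T)$; $T$ is $\Sigma_1$-consistent in $\mathfrak{L}$ if there is no $\Sigma_1$-formula $\varphi$ with $T\vdash_\mathfrak{L}\varphi$ and $T\vdash_\mathfrak{L}\neg\varphi$; $T$ is essentially undecidable in $\mathfrak{L}$ if it is consistent and each consistent theory strengthening it is undecidable. -}

module Defs where

open import Data.Nat using (ℕ; zero; suc; _+_; _*_; _^_; _<_; _≡ᵇ_)
open import Data.Bool using (if_then_else_)
open import Data.Fin using (Fin)
open import Data.Vec using (Vec; []; _∷_; lookup)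
open import Data.Product using (Σ; ∃; _×_; _,_)
open import Data.Sum using (_⊎_; inj₁; inj₂)
open import Data.Unit using (⊤)
open import Data.Empty using () renaming (⊥ to Empty)
open import Relation.Nullary using (¬_)
open import Relation.Binary.PropositionalEquality using (_≡_)

data Term : Set where
  var  : ℕ → Term
  zer  : Term
  S    : Term → Term

infixr 5 _⇒_
infixr 6 _∨′_
infixr 7 _∧′_
infix  8 _≐_ _≼_

data Formula : Set where
  _≐_   : Term → Term → Formula
  _≼_   : Term → Term → Formula
  A     : Term → Term → Term → Formula
  M     : Term → Term → Term → Formula
  ⊥′    : Formula
  _⇒_   : Formula → Formula → Formula
  _∧′_  : Formula → Formula → Formula
  _∨′_  : Formula → Formula → Formula
  ∀′    : ℕ → Formula → Formula
  ∃′    : ℕ → Formula → Formula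

¬′_ : Formula → Formula
¬′ φ = φ ⇒ ⊥′

_⇔′_ : Formula → Formula → Formula
φ ⇔′ ψ = (φ ⇒ ψ) ∧′ (ψ ⇒ φ)

_≠′_ : Term → Term → Formula
t ≠′ s = ¬′ (t ≐ s)

num : ℕ → Term
num zero    = zer
num (suc n) = S (num n)

data OccT (x : ℕ) : Term → Set where
  here : OccT x (var x)
  inS  : ∀ {t} → OccT x t → OccT x (S t)

data Free (x : ℕ) : Formula → Set where
  eqˡ  : ∀ {t s} → OccT x t → Free x (t ≐ s)
  eqʳ  : ∀ {t s} → OccT x s → Free x (t ≐ s)
  leˡ  : ∀ {t s} → OccT x t → Free x (t ≼ s)
  leʳ  : ∀ {t s} → OccT x s → Free x (t ≼ s)
  A₁   : ∀ {t s u} → OccT x t → Free x (A t s u)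
  A₂   : ∀ {t s u} → OccT x s → Free x (A t s u)
  A₃   : ∀ {t s u} → OccT x u → Free x (A t s u)
  M₁   : ∀ {t s u} → OccT x t → Free x (M t s u)
  M₂   : ∀ {t s u} → OccT x s → Free x (M t s u)
  M₃   : ∀ {t s u} → OccT x u → Free x (M t s u)
  ⇒ˡ   : ∀ {φ ψ} → Free x φ → Free x (φ ⇒ ψ)
  ⇒ʳ   : ∀ {φ ψ} → Free x ψ → Free x (φ ⇒ ψ)
  ∧ˡ   : ∀ {φ ψ} → Free x φ → Free x (φ ∧′ ψ)
  ∧ʳ   : ∀ {φ ψ} → Free x ψ → Free x (φ ∧′ ψ)
  ∨ˡ   : ∀ {φ ψ} → Free x φ → Free x (φ ∨′ ψ)
  ∨ʳ   : ∀ {φ ψ} → Free x ψ → Free x (φ ∨′ ψ)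
  all  : ∀ {y φ} → ¬ (x ≡ y) → Free x φ → Free x (∀′ y φ)
  ex   : ∀ {y φ} → ¬ (x ≡ y) → Free x φ → Free x (∃′ y φ)

_[_/_]ₜ : Term → Term → ℕ → Term
var y [ s / x ]ₜ = if x ≡ᵇ y then s else var y
zer   [ s / x ]ₜ = zer
S t   [ s / x ]ₜ = S (t [ s / x ]ₜ)

_[_/_] : Formula → Term → ℕ → Formula
(t ≐ u)   [ s / x ] = (t [ s / x ]ₜ) ≐ (u [ s / x ]ₜ)
(t ≼ u)   [ s / x ] = (t [ s / x ]ₜ) ≼ (u [ s / x ]ₜ)
A t u v   [ s / x ] = A (t [ s / x ]ₜ) (u [ s / x ]ₜ) (v [ s / x ]ₜ)
M t u v   [ s / x ] = M (t [ s / x ]ₜ) (u [ s / x ]ₜ) (v [ s / x ]ₜ)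
⊥′        [ s / x ] = ⊥′
(φ ⇒ ψ)   [ s / x ] = (φ [ s / x ]) ⇒ (ψ [ s / x ])
(φ ∧′ ψ)  [ s / x ] = (φ [ s / x ]) ∧′ (ψ [ s / x ])
(φ ∨′ ψ)  [ s / x ] = (φ [ s / x ]) ∨′ (ψ [ s / x ])
∀′ y φ    [ s / x ] = if x ≡ᵇ y then ∀′ y φ else ∀′ y (φ [ s / x ])
∃′ y φ    [ s / x ] = if x ≡ᵇ y then ∃′ y φ else ∃′ y (φ [ s / x ])

Substitutable : Term → ℕ → Formula → Set
Substitutable s x (t ≐ u)  = ⊤
Substitutable s x (t ≼ u)  = ⊤
Substitutable s x (A _ _ _) = ⊤
Substitutable s x (M _ _ _) = ⊤
Substitutable s x ⊥′       = ⊤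
Substitutable s x (φ ⇒ ψ)  = Substitutable s x φ × Substitutable s x ψ
Substitutable s x (φ ∧′ ψ) = Substitutable s x φ × Substitutable s x ψ
Substitutable s x (φ ∨′ ψ) = Substitutable s x φ × Substitutable s x ψ
Substitutable s x (∀′ y φ) =
  ¬ Free x (∀′ y φ) ⊎ (¬ OccT y s × Substitutable s x φ)
Substitutable s x (∃′ y φ) =
  ¬ Free x (∃′ y φ) ⊎ (¬ OccT y s × Substitutable s x φ)

Theory : Set₁
Theory = Formula → Set

infix 3 _⊢_

data _⊢_ (T : Theory) : Formula → Set where
  hyp   : ∀ {φ} → T φ → T ⊢ φ
  ax-id   : ∀ φ → T ⊢ φ ⇒ φ
  ax-∧₁   : ∀ φ ψ → T ⊢ φ ∧′ ψ ⇒ φ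
  ax-∧₂   : ∀ φ ψ → T ⊢ φ ∧′ ψ ⇒ ψ
  ax-∨₁   : ∀ φ ψ → T ⊢ φ ⇒ φ ∨′ ψ
  ax-∨₂   : ∀ φ ψ → T ⊢ ψ ⇒ φ ∨′ ψ
  r-wk    : ∀ {φ} ψ → T ⊢ φ → T ⊢ ψ ⇒ φ
  r-mp    : ∀ {φ ψ} → T ⊢ φ → T ⊢ φ ⇒ ψ → T ⊢ ψ
  r-as    : ∀ {φ} ψ → T ⊢ φ → T ⊢ (φ ⇒ ψ) ⇒ ψ
  r-tr    : ∀ {φ ψ χ} → T ⊢ φ ⇒ ψ → T ⊢ ψ ⇒ χ → T ⊢ φ ⇒ χ
  r-¬∧    : ∀ {φ ψ} → T ⊢ (¬′ φ) ∨′ (¬′ ψ) → T ⊢ ¬′ (φ ∧′ ψ)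
  r-∧I    : ∀ {φ ψ χ} → T ⊢ χ ⇒ φ → T ⊢ χ ⇒ ψ → T ⊢ χ ⇒ φ ∧′ ψ
  r-∨E    : ∀ {φ ψ χ} → T ⊢ φ ⇒ χ → T ⊢ ψ ⇒ χ → T ⊢ φ ∨′ ψ ⇒ χ
  ax-∀    : ∀ x φ t → Substitutable t x φ → T ⊢ ∀′ x φ ⇒ (φ [ t / x ])
  ax-∃    : ∀ x φ t → Substitutable t x φ → T ⊢ (φ [ t / x ]) ⇒ ∃′ x φ
  r-∀     : ∀ {χ ψ} x → ¬ Free x χ → T ⊢ χ ⇒ ψ → T ⊢ χ ⇒ ∀′ x ψ
  r-∃     : ∀ {χ ψ} x → ¬ Free x χ → T ⊢ ψ ⇒ χ → T ⊢ ∃′ x ψ ⇒ χ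
  eq-refl  : ∀ x → T ⊢ var x ≐ var x
  eq-sym   : ∀ x y → T ⊢ var x ≐ var y ⇒ var y ≐ var x
  eq-trans : ∀ x y z → T ⊢ var x ≐ var y ⇒ (var y ≐ var z ⇒ var x ≐ var z)
  eq-fun   : ∀ x y t → T ⊢ var x ≐ var y ⇒ t ≐ (t [ var y / x ]ₜ)
  eq-sub   : ∀ x y φ → Substitutable (var y) x φ →
             T ⊢ var x ≐ var y ⇒ (φ ⇒ (φ [ var y / x ]))

∀≤ : ℕ → ℕ → Formula → Formula
∀≤ x y φ = ∀′ x ((¬′ (var x ≼ var y)) ∨′ φ)

∃≤ : ℕ → ℕ → Formula → Formula
∃≤ x y φ = ∃′ x ((var x ≼ var y) ∧′ φ)

data Δ₀ : Formula → Set where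
  d-eq  : ∀ t s → Δ₀ (t ≐ s)
  d-le  : ∀ t s → Δ₀ (t ≼ s)
  d-A   : ∀ t s u → Δ₀ (A t s u)
  d-M   : ∀ t s u → Δ₀ (M t s u)
  d-⊥   : Δ₀ ⊥′
  d-⇒   : ∀ {φ ψ} → Δ₀ φ → Δ₀ ψ → Δ₀ (φ ⇒ ψ)
  d-∧   : ∀ {φ ψ} → Δ₀ φ → Δ₀ ψ → Δ₀ (φ ∧′ ψ)
  d-∨   : ∀ {φ ψ} → Δ₀ φ → Δ₀ ψ → Δ₀ (φ ∨′ ψ)
  d-∀≤  : ∀ {φ} x y → ¬ (x ≡ y) → Δ₀ φ → Δ₀ (∀≤ x y φ)
  d-∃≤  : ∀ {φ} x y → ¬ (x ≡ y) → Δ₀ φ → Δ₀ (∃≤ x y φ)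

data Σ₁ : Formula → Set where
  sigma : ∀ x {ψ} → Δ₀ ψ → Σ₁ (∃′ x ψ)

upToDisj : Term → ℕ → Formula
upToDisj x zero    = x ≐ num zero
upToDisj x (suc n) = upToDisj x n ∨′ (x ≐ num (suc n))

data R∽ : Theory where
  ax-A   : ∀ x m n → R∽ (A (num m) (num n) (var x) ⇔′ (num (m + n) ≐ var x))
  ax-M   : ∀ x m n → R∽ (M (num m) (num n) (var x) ⇔′ (num (m * n) ≐ var x))
  ax-neq : ∀ m n → ¬ (m ≡ n) → R∽ (num m ≠′ num n)
  ax-le  : ∀ x n → R∽ ((var x ≼ num n) ⇔′ upToDisj (var x) n)
  ax-tot : ∀ x n → R∽ ((var x ≼ num n) ∨′ (num n ≼ var x))
  ax-dec : ∀ x n → R∽ ((var x ≼ num n) ∨′ ¬′ (var x ≼ num n))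

Strengthens : Theory → Theory → Set
Strengthens T U = ∀ φ → U φ → T ⊢ φ

Σ₁-Consistent : Theory → Set
Σ₁-Consistent T = ¬ (Σ Formula λ φ → Σ₁ φ × (T ⊢ φ) × (T ⊢ ¬′ φ))

pair : ℕ → ℕ → ℕ
pair m n = 2 ^ m * (2 * n + 1)

codeT : Term → ℕ
codeT (var x) = pair 0 x
codeT zer     = pair 1 0
codeT (S t)   = pair 2 (codeT t)

triple : ℕ → ℕ → ℕ → ℕ
triple a b c = pair a (pair b c)

code : Formula → ℕ
code (t ≐ s)   = triple 0 (codeT t) (codeT s)
code (t ≼ s)   = triple 1 (codeT t) (codeT s)
code (A t s u) = triple 2 (codeT t) (pair (codeT s) (codeT u))
code (M t s u) = triple 3 (codeT t) (pair (codeT s) (codeT u))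
code ⊥′        = pair 4 0
code (φ ⇒ ψ)   = triple 5 (code φ) (code ψ)
code (φ ∧′ ψ)  = triple 6 (code φ) (code ψ)
code (φ ∨′ ψ)  = triple 7 (code φ) (code ψ)
code (∀′ x φ)  = triple 8 x (code φ)
code (∃′ x φ)  = triple 9 x (code φ)

data Rec : ℕ → Set where
  zeroF : Rec 0
  succF : Rec 1
  proj  : ∀ {n} → Fin n → Rec n
  comp  : ∀ {k n} → Rec k → Vec (Rec n) k → Rec n
  prec  : ∀ {n} → Rec n → Rec (suc (suc n)) → Rec (suc n)
  mu    : ∀ {n} → Rec (suc n) → Rec n

mutual
  data _⟦_⟧⇓_ : ∀ {n} → Rec n → Vec ℕ n → ℕ → Set where
    e-zero : zeroF ⟦ [] ⟧⇓ 0
    e-succ : ∀ x → succF ⟦ x ∷ [] ⟧⇓ suc x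
    e-proj : ∀ {n} (i : Fin n) xs → proj i ⟦ xs ⟧⇓ lookup xs i
    e-comp : ∀ {k n} {f : Rec k} {gs : Vec (Rec n) k} {xs ys y} →
             gs ⟦ xs ⟧⇓* ys → f ⟦ ys ⟧⇓ y → comp f gs ⟦ xs ⟧⇓ y
    e-prec0 : ∀ {n} {f : Rec n} {g} {xs y} →
              f ⟦ xs ⟧⇓ y → prec f g ⟦ 0 ∷ xs ⟧⇓ y
    e-precS : ∀ {n} {f : Rec n} {g} {m xs r y} →
              prec f g ⟦ m ∷ xs ⟧⇓ r → g ⟦ m ∷ r ∷ xs ⟧⇓ y →
              prec f g ⟦ suc m ∷ xs ⟧⇓ y
    e-mu   : ∀ {n} {f : Rec (suc n)} {xs y} →
             f ⟦ y ∷ xs ⟧⇓ 0 →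
             (∀ z → z < y → ∃ λ w → f ⟦ z ∷ xs ⟧⇓ suc w) →
             mu f ⟦ xs ⟧⇓ y

  data _⟦_⟧⇓*_ {n} : ∀ {k} → Vec (Rec n) k → Vec ℕ n → Vec ℕ k → Set where
    []  : ∀ {xs} → [] ⟦ xs ⟧⇓* []
    _∷_ : ∀ {k} {g} {gs : Vec (Rec n) k} {xs y ys} →
          g ⟦ xs ⟧⇓ y → gs ⟦ xs ⟧⇓* ys → (g ∷ gs) ⟦ xs ⟧⇓* (y ∷ ys)

DecidableTh : Theory → Set
DecidableTh T = Σ (Rec 1) λ f → ∀ φ →
  (f ⟦ code φ ∷ [] ⟧⇓ 1 × (T ⊢ φ)) ⊎ (f ⟦ code φ ∷ [] ⟧⇓ 0 × ¬ (T ⊢ φ))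

Undecidable : Theory → Set
Undecidable T = ¬ DecidableTh T

{-# OPTIONS --safe #-}
module Submission where

-- Soundness in the standard model gives Σ₁-consistency of R∽.  For the second part, suppose f decides T,
-- and let h n be the value of f at the diagonal sentence built from the formula coded by n.  The graph of
-- a recursive function is expressed by formulas whose quantifiers are all bounded by one variable w; such
-- formulas are decided by R∽ on numerals, and "h x = y" holds iff its formula holds for all large w.
-- Rosser's comparison of witnesses, "w witnesses h x = 0 and no w′ ≤ w witnesses h x = 1", is written as
--   ∃ w. ¬ ((∃ w′ ≤ w. w′ witnesses h x = 1) ∨ ¬ (w witnesses h x = 0)),
-- because without φ → ¬¬φ only the negation of a formula provable outright can be refuted: if w₀ witnesses
-- h x = 1, then w ≤ w₀ yields the second disjunct and w₀ ≤ w the first, so totality of ≤ proves the disjunction.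

open import Defs
import Data.Bool as Bool
open import Data.Bool using (true; false; if_then_else_)
open import Data.Empty using (⊥; ⊥-elim)
open import Data.Fin using (Fin; zero; suc; _↑ˡ_; _↑ʳ_)
import Data.List as List
open import Data.List using (List; []; _∷_)
open import Data.List.Membership.Propositional using (_∈_)
open import Data.List.Membership.Propositional.Properties using (∈-map⁺; ∈-map⁻)
import Data.List.Relation.Unary.All as ListAll
import Data.List.Relation.Unary.All.Properties as ListAll
open import Data.List.Relation.Unary.Any using (here; there)
open import Data.Nat using (ℕ; zero; suc; _+_; _*_; _^_; _∸_; _⊔_; _!; _≤_; _<_; _≡ᵇ_; _≤?_; z≤n; s≤s; NonZero)
open import Data.Nat.Coprimality using (Coprime; coprime-divisor)
import Data.Nat.Coprimality as Coprimality
open import Data.Nat.Divisibility using (_∣_; _∣?_; divides; ∣⇒≤; ∣m+n∣m⇒∣n; ∣n⇒∣m*n; ∣1⇒≡1; ∣-trans; m≤n⇒m!∣n!; m∣m*n)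
open import Data.Nat.ListAction using (product)
open import Data.Nat.ListAction.Properties using (∈⇒∣product; product≢0)
open import Data.Nat.Properties
import Data.Product as Prod
open import Data.Product using (∃; ∃₂; _×_; _,_; proj₁; proj₂)
import Data.Sum as Sum
open import Data.Sum using (_⊎_; inj₁; inj₂; [_,_]′)
open import Data.Unit using (tt)
open import Data.Vec using (Vec; []; _∷_; lookup; map; _++_; tabulate)
open import Data.Vec.Properties using (lookup-map; map-∘; map-cong; lookup-++ˡ; lookup-++ʳ; tabulate∘lookup; tabulate-∘; tabulate-cong)
open import Data.Vec.Relation.Unary.All using (All; []; _∷_)
import Data.Vec.Relation.Unary.All as All
import Data.Vec.Relation.Unary.All.Properties as All
open import Function using (_∘_)
open import Function.Bundles using (_⇔_; mk⇔; Equivalence)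
open import Relation.Binary.Definitions using (tri<; tri≈; tri>)
open import Relation.Binary.PropositionalEquality
open import Relation.Nullary using (¬_; yes; no; Dec)

≡ᵇ-refl : ∀ x → (x ≡ᵇ x) ≡ true
≡ᵇ-refl zero    = refl
≡ᵇ-refl (suc x) = ≡ᵇ-refl x

≢⇒≡ᵇ-false : ∀ x y → x ≢ y → (x ≡ᵇ y) ≡ false
≢⇒≡ᵇ-false x y x≢y with x ≡ᵇ y in eq
... | false = refl
... | true  = ⊥-elim (x≢y (≡ᵇ⇒≡ x y (subst Bool.T (sym eq) tt)))

-- The standard model

Val : Set
Val = ℕ → ℕ

_[_↦_] : Val → ℕ → ℕ → Val
(ρ [ x ↦ n ]) y = if x ≡ᵇ y then n else ρ y

update-hit : ∀ ρ x n → (ρ [ x ↦ n ]) x ≡ n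
update-hit ρ x n rewrite ≡ᵇ-refl x = refl

update-miss : ∀ ρ x n {y} → x ≢ y → (ρ [ x ↦ n ]) y ≡ ρ y
update-miss ρ x n {y} x≢y rewrite ≢⇒≡ᵇ-false x y x≢y = refl

valT : Term → Val → ℕ
valT (var x) ρ = ρ x
valT zer     ρ = 0
valT (S t)   ρ = suc (valT t ρ)

infix 4 _⊨_

_⊨_ : Val → Formula → Set
ρ ⊨ t ≐ s    = valT t ρ ≡ valT s ρ
ρ ⊨ t ≼ s    = valT t ρ ≤ valT s ρ
ρ ⊨ A t s u  = valT t ρ + valT s ρ ≡ valT u ρ
ρ ⊨ M t s u  = valT t ρ * valT s ρ ≡ valT u ρ
ρ ⊨ ⊥′       = ⊥
ρ ⊨ φ ⇒ ψ    = ρ ⊨ φ → ρ ⊨ ψ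
ρ ⊨ φ ∧′ ψ   = ρ ⊨ φ × ρ ⊨ ψ
ρ ⊨ φ ∨′ ψ   = ρ ⊨ φ ⊎ ρ ⊨ ψ
ρ ⊨ ∀′ x φ   = ∀ n → ρ [ x ↦ n ] ⊨ φ
ρ ⊨ ∃′ x φ   = ∃ λ n → ρ [ x ↦ n ] ⊨ φ

valT-cong : ∀ t {ρ σ} → (∀ x → OccT x t → ρ x ≡ σ x) → valT t ρ ≡ valT t σ
valT-cong (var x) ρ≡σ = ρ≡σ x here
valT-cong zer     ρ≡σ = refl
valT-cong (S t)   ρ≡σ = cong suc (valT-cong t λ x o → ρ≡σ x (inS o))

update-cong : ∀ {φ y n ρ σ} → (∀ x → y ≢ x → Free x φ → ρ x ≡ σ x) →
              ∀ x → Free x φ → (ρ [ y ↦ n ]) x ≡ (σ [ y ↦ n ]) x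
update-cong {y = y} {n} {ρ} {σ} ρ≡σ x o with y ≟ x
... | yes refl = trans (update-hit ρ y n) (sym (update-hit σ y n))
... | no y≢x   = trans (update-miss ρ y n y≢x) (trans (ρ≡σ x y≢x o) (sym (update-miss σ y n y≢x)))

⊨-cong : ∀ φ {ρ σ} → (∀ x → Free x φ → ρ x ≡ σ x) → ρ ⊨ φ → σ ⊨ φ
⊨-cong (t ≐ s) e p =
  trans (sym (valT-cong t λ x → e x ∘ eqˡ)) (trans p (valT-cong s λ x → e x ∘ eqʳ))
⊨-cong (t ≼ s) e p =
  subst₂ _≤_ (valT-cong t λ x → e x ∘ leˡ) (valT-cong s λ x → e x ∘ leʳ) p
⊨-cong (A t s u) e p =
  trans (sym (cong₂ _+_ (valT-cong t λ x → e x ∘ A₁) (valT-cong s λ x → e x ∘ A₂)))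
        (trans p (valT-cong u λ x → e x ∘ A₃))
⊨-cong (M t s u) e p =
  trans (sym (cong₂ _*_ (valT-cong t λ x → e x ∘ M₁) (valT-cong s λ x → e x ∘ M₂)))
        (trans p (valT-cong u λ x → e x ∘ M₃))
⊨-cong (φ ⇒ ψ) e p q =
  ⊨-cong ψ (λ x → e x ∘ ⇒ʳ) (p (⊨-cong φ (λ x → sym ∘ e x ∘ ⇒ˡ) q))
⊨-cong (φ ∧′ ψ) e (p , q) = ⊨-cong φ (λ x → e x ∘ ∧ˡ) p , ⊨-cong ψ (λ x → e x ∘ ∧ʳ) q
⊨-cong (φ ∨′ ψ) e (inj₁ p) = inj₁ (⊨-cong φ (λ x → e x ∘ ∨ˡ) p)
⊨-cong (φ ∨′ ψ) e (inj₂ q) = inj₂ (⊨-cong ψ (λ x → e x ∘ ∨ʳ) q)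
⊨-cong (∀′ y φ) e p n =
  ⊨-cong φ (update-cong λ x y≢x → e x ∘ all (y≢x ∘ sym)) (p n)
⊨-cong (∃′ y φ) e (n , p) =
  n , ⊨-cong φ (update-cong λ x y≢x → e x ∘ ex (y≢x ∘ sym)) p

valT-subst : ∀ t s x ρ → valT (t [ s / x ]ₜ) ρ ≡ valT t (ρ [ x ↦ valT s ρ ])
valT-subst (var y) s x ρ with x ≡ᵇ y
... | true  = refl
... | false = refl
valT-subst zer   s x ρ = refl
valT-subst (S t) s x ρ = cong suc (valT-subst t s x ρ)

update-shadow : ∀ x ρ v n z → (ρ [ x ↦ n ]) z ≡ (ρ [ x ↦ v ] [ x ↦ n ]) z
update-shadow x ρ v n z with x ≡ᵇ z
... | true  = refl
... | false = refl

update-nonfree : ∀ {x φ} → ¬ Free x φ → ∀ ρ v z → Free z φ → ρ z ≡ (ρ [ x ↦ v ]) z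
update-nonfree {x} x∉φ ρ v z o = sym (update-miss ρ x v λ { refl → x∉φ o })

update-comm : ∀ {x y s} → x ≢ y → ¬ OccT y s → ∀ ρ n z →
              (ρ [ y ↦ n ] [ x ↦ valT s (ρ [ y ↦ n ]) ]) z ≡ (ρ [ x ↦ valT s ρ ] [ y ↦ n ]) z
update-comm {x} {y} {s} x≢y y∉s ρ n z with x ≟ z
... | yes refl = begin
      (ρ [ y ↦ n ] [ x ↦ valT s (ρ [ y ↦ n ]) ]) x  ≡⟨ update-hit (ρ [ y ↦ n ]) x _ ⟩
      valT s (ρ [ y ↦ n ])                          ≡⟨ valT-cong s (λ u o → update-miss ρ y n λ { refl → y∉s o }) ⟩
      valT s ρ                                      ≡⟨ update-hit ρ x _ ⟨
      (ρ [ x ↦ valT s ρ ]) x                        ≡⟨ update-miss (ρ [ x ↦ valT s ρ ]) y n (x≢y ∘ sym) ⟨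
      (ρ [ x ↦ valT s ρ ] [ y ↦ n ]) x              ∎ where open ≡-Reasoning
... | no x≢z = trans (update-miss (ρ [ y ↦ n ]) x _ x≢z) (lemma (y ≡ᵇ z))
  where
    lemma : ∀ b → (if b then n else ρ z) ≡ (if b then n else (ρ [ x ↦ valT s ρ ]) z)
    lemma true  = refl
    lemma false = sym (update-miss ρ x _ x≢z)

cong₃ : ∀ {a b c d} {A : Set a} {B : Set b} {C : Set c} {D : Set d} (f : A → B → C → D)
        {x x′ y y′ z z′} → x ≡ x′ → y ≡ y′ → z ≡ z′ → f x y z ≡ f x′ y′ z′
cong₃ f refl refl refl = refl

subst-nonfreeT : ∀ t {s x} → ¬ OccT x t → (t [ s / x ]ₜ) ≡ t
subst-nonfreeT (var y) {x = x} x∉t rewrite ≢⇒≡ᵇ-false x y (λ { refl → x∉t here }) = refl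
subst-nonfreeT zer     x∉t = refl
subst-nonfreeT (S t)   x∉t = cong S (subst-nonfreeT t (x∉t ∘ inS))

subst-nonfree : ∀ φ {s x} → ¬ Free x φ → (φ [ s / x ]) ≡ φ
subst-nonfree (t ≐ u) n = cong₂ _≐_ (subst-nonfreeT t (n ∘ eqˡ)) (subst-nonfreeT u (n ∘ eqʳ))
subst-nonfree (t ≼ u) n = cong₂ _≼_ (subst-nonfreeT t (n ∘ leˡ)) (subst-nonfreeT u (n ∘ leʳ))
subst-nonfree (A t u v) n =
  cong₃ A (subst-nonfreeT t (n ∘ A₁)) (subst-nonfreeT u (n ∘ A₂)) (subst-nonfreeT v (n ∘ A₃))
subst-nonfree (M t u v) n =
  cong₃ M (subst-nonfreeT t (n ∘ M₁)) (subst-nonfreeT u (n ∘ M₂)) (subst-nonfreeT v (n ∘ M₃))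
subst-nonfree ⊥′ n = refl
subst-nonfree (φ ⇒ ψ)  n = cong₂ _⇒_ (subst-nonfree φ (n ∘ ⇒ˡ)) (subst-nonfree ψ (n ∘ ⇒ʳ))
subst-nonfree (φ ∧′ ψ) n = cong₂ _∧′_ (subst-nonfree φ (n ∘ ∧ˡ)) (subst-nonfree ψ (n ∘ ∧ʳ))
subst-nonfree (φ ∨′ ψ) n = cong₂ _∨′_ (subst-nonfree φ (n ∘ ∨ˡ)) (subst-nonfree ψ (n ∘ ∨ʳ))
subst-nonfree (∀′ y φ) {x = x} n with x ≟ y
... | yes refl rewrite ≡ᵇ-refl x = refl
... | no x≢y rewrite ≢⇒≡ᵇ-false x y x≢y = cong (∀′ y) (subst-nonfree φ (n ∘ all x≢y))
subst-nonfree (∃′ y φ) {x = x} n with x ≟ y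
... | yes refl rewrite ≡ᵇ-refl x = refl
... | no x≢y rewrite ≢⇒≡ᵇ-false x y x≢y = cong (∃′ y) (subst-nonfree φ (n ∘ ex x≢y))

⊨-subst : ∀ φ s x ρ → Substitutable s x φ → ρ ⊨ φ [ s / x ] ⇔ ρ [ x ↦ valT s ρ ] ⊨ φ
⊨-subst (t ≐ u) s x ρ _ rewrite valT-subst t s x ρ | valT-subst u s x ρ = mk⇔ (λ p → p) (λ p → p)
⊨-subst (t ≼ u) s x ρ _ rewrite valT-subst t s x ρ | valT-subst u s x ρ = mk⇔ (λ p → p) (λ p → p)
⊨-subst (A t u v) s x ρ _
  rewrite valT-subst t s x ρ | valT-subst u s x ρ | valT-subst v s x ρ = mk⇔ (λ p → p) (λ p → p)
⊨-subst (M t u v) s x ρ _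
  rewrite valT-subst t s x ρ | valT-subst u s x ρ | valT-subst v s x ρ = mk⇔ (λ p → p) (λ p → p)
⊨-subst ⊥′ s x ρ _ = mk⇔ (λ p → p) (λ p → p)
⊨-subst (φ ⇒ ψ) s x ρ (a , b) = mk⇔ (λ p → B.to ∘ p ∘ A.from) (λ p → B.from ∘ p ∘ A.to)
  where module A = Equivalence (⊨-subst φ s x ρ a)
        module B = Equivalence (⊨-subst ψ s x ρ b)
⊨-subst (φ ∧′ ψ) s x ρ (a , b) = mk⇔ (Prod.map A.to B.to) (Prod.map A.from B.from)
  where module A = Equivalence (⊨-subst φ s x ρ a)
        module B = Equivalence (⊨-subst ψ s x ρ b)
⊨-subst (φ ∨′ ψ) s x ρ (a , b) = mk⇔ (Sum.map A.to B.to) (Sum.map A.from B.from)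
  where module A = Equivalence (⊨-subst φ s x ρ a)
        module B = Equivalence (⊨-subst ψ s x ρ b)
⊨-subst (∀′ y φ) s x ρ ok with x ≟ y
... | yes refl rewrite ≡ᵇ-refl x =
      mk⇔ (λ p n → ⊨-cong φ (λ z _ → update-shadow x ρ _ n z) (p n))
          (λ p n → ⊨-cong φ (λ z _ → sym (update-shadow x ρ _ n z)) (p n))
... | no x≢y rewrite ≢⇒≡ᵇ-false x y x≢y with ok
-- This disjunct allows `y` to occur in `s`. No capture arises, since the body is left unchanged and
-- does not depend on `x`.
...   | inj₁ nf rewrite subst-nonfree φ {s} (nf ∘ all x≢y) =
        mk⇔ (⊨-cong (∀′ y φ) (update-nonfree nf ρ _))
            (⊨-cong (∀′ y φ) (λ z o → sym (update-nonfree nf ρ _ z o)))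
...   | inj₂ (y∉s , ok′) =
        mk⇔ (λ p n → ⊨-cong φ (λ z _ → update-comm x≢y y∉s ρ n z) (Equivalence.to (ih n) (p n)))
            (λ p n → Equivalence.from (ih n) (⊨-cong φ (λ z _ → sym (update-comm x≢y y∉s ρ n z)) (p n)))
  where ih = λ n → ⊨-subst φ s x (ρ [ y ↦ n ]) ok′
⊨-subst (∃′ y φ) s x ρ ok with x ≟ y
... | yes refl rewrite ≡ᵇ-refl x =
      mk⇔ (λ (n , p) → n , ⊨-cong φ (λ z _ → update-shadow x ρ _ n z) p)
          (λ (n , p) → n , ⊨-cong φ (λ z _ → sym (update-shadow x ρ _ n z)) p)
... | no x≢y rewrite ≢⇒≡ᵇ-false x y x≢y with ok
...   | inj₁ nf rewrite subst-nonfree φ {s} (nf ∘ ex x≢y) =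
        mk⇔ (⊨-cong (∃′ y φ) (update-nonfree nf ρ _))
            (⊨-cong (∃′ y φ) (λ z o → sym (update-nonfree nf ρ _ z o)))
...   | inj₂ (y∉s , ok′) =
        mk⇔ (λ (n , p) → n , ⊨-cong φ (λ z _ → update-comm x≢y y∉s ρ n z) (Equivalence.to (ih n) p))
            (λ (n , p) → n , Equivalence.from (ih n) (⊨-cong φ (λ z _ → sym (update-comm x≢y y∉s ρ n z)) p))
  where ih = λ n → ⊨-subst φ s x (ρ [ y ↦ n ]) ok′

update-id : ∀ ρ x z → ρ z ≡ (ρ [ x ↦ ρ x ]) z
update-id ρ x z with x ≟ z
... | yes refl = sym (update-hit ρ x _)
... | no x≢z   = sym (update-miss ρ x _ x≢z)

-- The instantiation and replacement axioms are the substitution lemmas `⊨-subst` and `valT-subst`;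
-- the quantifier rules use that a variable not free in `χ` can be reassigned.
⊢-sound : ∀ {T} → (∀ {φ} → T φ → ∀ ρ → ρ ⊨ φ) → ∀ {φ} → T ⊢ φ → ∀ ρ → ρ ⊨ φ
⊢-sound T⊨ (hyp p) ρ = T⊨ p ρ
⊢-sound T⊨ (ax-id φ) ρ p = p
⊢-sound T⊨ (ax-∧₁ φ ψ) ρ = proj₁
⊢-sound T⊨ (ax-∧₂ φ ψ) ρ = proj₂
⊢-sound T⊨ (ax-∨₁ φ ψ) ρ = inj₁
⊢-sound T⊨ (ax-∨₂ φ ψ) ρ = inj₂
⊢-sound T⊨ (r-wk ψ d) ρ _ = ⊢-sound T⊨ d ρ
⊢-sound T⊨ (r-mp d e) ρ = ⊢-sound T⊨ e ρ (⊢-sound T⊨ d ρ)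
⊢-sound T⊨ (r-as ψ d) ρ k = k (⊢-sound T⊨ d ρ)
⊢-sound T⊨ (r-tr d e) ρ p = ⊢-sound T⊨ e ρ (⊢-sound T⊨ d ρ p)
⊢-sound T⊨ (r-¬∧ d) ρ (p , q) = [ (λ np → np p) , (λ nq → nq q) ]′ (⊢-sound T⊨ d ρ)
⊢-sound T⊨ (r-∧I d e) ρ p = ⊢-sound T⊨ d ρ p , ⊢-sound T⊨ e ρ p
⊢-sound T⊨ (r-∨E d e) ρ = [ ⊢-sound T⊨ d ρ , ⊢-sound T⊨ e ρ ]′
⊢-sound T⊨ (ax-∀ x φ t ok) ρ p = Equivalence.from (⊨-subst φ t x ρ ok) (p (valT t ρ))
⊢-sound T⊨ (ax-∃ x φ t ok) ρ p = valT t ρ , Equivalence.to (⊨-subst φ t x ρ ok) p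
⊢-sound T⊨ (r-∀ {χ} x x∉χ d) ρ p n =
  ⊢-sound T⊨ d (ρ [ x ↦ n ]) (⊨-cong χ (update-nonfree x∉χ ρ n) p)
⊢-sound T⊨ (r-∃ {χ} x x∉χ d) ρ (n , p) =
  ⊨-cong χ (λ z o → sym (update-nonfree x∉χ ρ n z o)) (⊢-sound T⊨ d (ρ [ x ↦ n ]) p)
⊢-sound T⊨ (eq-refl x) ρ = refl
⊢-sound T⊨ (eq-sym x y) ρ = sym
⊢-sound T⊨ (eq-trans x y z) ρ = trans
⊢-sound T⊨ (eq-fun x y t) ρ p rewrite valT-subst t (var y) x ρ | sym p =
  valT-cong t λ z _ → update-id ρ x z
⊢-sound T⊨ (eq-sub x y φ ok) ρ p q = Equivalence.from (⊨-subst φ (var y) x ρ ok)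
  (⊨-cong φ (λ z _ → trans (update-id ρ x z) (cong (λ v → (ρ [ x ↦ v ]) z) p)) q)

valT-num : ∀ n ρ → valT (num n) ρ ≡ n
valT-num zero    ρ = refl
valT-num (suc n) ρ = cong suc (valT-num n ρ)

upToDisj⇔≤ : ∀ t n ρ → ρ ⊨ upToDisj t n ⇔ valT t ρ ≤ n
upToDisj⇔≤ t n ρ = mk⇔ (to n) (from n)
  where
    to : ∀ n → ρ ⊨ upToDisj t n → valT t ρ ≤ n
    to zero    p        = ≤-reflexive p
    to (suc n) (inj₁ p) = m≤n⇒m≤1+n (to n p)
    to (suc n) (inj₂ p) = ≤-reflexive (trans p (valT-num (suc n) ρ))
    from : ∀ n → valT t ρ ≤ n → ρ ⊨ upToDisj t n
    from zero    p = n≤0⇒n≡0 p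
    from (suc n) p with m≤n⇒m<n∨m≡n p
    ... | inj₁ (s≤s q) = inj₁ (from n q)
    ... | inj₂ q       = inj₂ (trans q (sym (valT-num (suc n) ρ)))

R∽-sound : ∀ {φ} → R∽ φ → ∀ ρ → ρ ⊨ φ
R∽-sound (ax-A x m n) ρ rewrite valT-num m ρ | valT-num n ρ | valT-num (m + n) ρ = (λ p → p) , (λ p → p)
R∽-sound (ax-M x m n) ρ rewrite valT-num m ρ | valT-num n ρ | valT-num (m * n) ρ = (λ p → p) , (λ p → p)
R∽-sound (ax-neq m n m≢n) ρ p = m≢n (trans (sym (valT-num m ρ)) (trans p (valT-num n ρ)))
R∽-sound (ax-le x n) ρ rewrite valT-num n ρ = E.from , E.to
  where module E = Equivalence (upToDisj⇔≤ (var x) n ρ)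
R∽-sound (ax-tot x n) ρ = ≤-total (ρ x) (valT (num n) ρ)
R∽-sound (ax-dec x n) ρ with ρ x ≤? valT (num n) ρ
... | yes p = inj₁ p
... | no ¬p = inj₂ ¬p

R∽-Σ₁-consistent : Σ₁-Consistent R∽
R∽-Σ₁-consistent (φ , _ , ⊢φ , ⊢¬φ) = ⊢-sound R∽-sound ⊢¬φ (λ _ → 0) (⊢-sound R∽-sound ⊢φ (λ _ → 0))

-- Bounded formulas and their decidability in R∽

data Tm (k : ℕ) : Set where
  v   : Fin k → Tm k
  lit : ℕ → Tm k
  s   : Tm k → Tm k

infix 8 _≈_ _≤ᶠ_
infixr 7 _∧ᶠ_
infixr 6 _∨ᶠ_

-- Well-scoped bounded formulas: truth, translation and decidability are defined by recursion with a
-- vector for the `k` variables, and closing a formula by numerals is a choice of vector. Bounds are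
-- variables, as in `Δ₀`.
data Fm (k : ℕ) : Set where
  _≈_ _≤ᶠ_    : Tm k → Tm k → Fm k
  add mul     : Tm k → Tm k → Tm k → Fm k
  ¬ᶠ_         : Fm k → Fm k
  _∧ᶠ_ _∨ᶠ_   : Fm k → Fm k → Fm k
  ∀ᶠ ∃ᶠ       : Fin k → Fm (suc k) → Fm k
  reindex     : Vec (Fin k) k → Fm k → Fm k

select : ∀ {a} {A : Set a} {k l} → Vec A k → Vec (Fin k) l → Vec A l
select σ = map (lookup σ)

select-map : ∀ {a b} {A : Set a} {B : Set b} (f : A → B) {k l} (σ : Vec A k) (is : Vec (Fin k) l) →
             select (map f σ) is ≡ map f (select σ is)
select-map f σ is = trans (map-cong (λ i → lookup-map i f σ) is) (map-∘ f (lookup σ) is)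

eval : ∀ {k} → Vec ℕ k → Tm k → ℕ
eval ρ (v i)   = lookup ρ i
eval ρ (lit n) = n
eval ρ (s t)   = suc (eval ρ t)

infix 4 _⊩_

_⊩_ : ∀ {k} → Vec ℕ k → Fm k → Set
ρ ⊩ t ≈ u     = eval ρ t ≡ eval ρ u
ρ ⊩ t ≤ᶠ u    = eval ρ t ≤ eval ρ u
ρ ⊩ add t u w = eval ρ t + eval ρ u ≡ eval ρ w
ρ ⊩ mul t u w = eval ρ t * eval ρ u ≡ eval ρ w
ρ ⊩ ¬ᶠ φ      = ¬ ρ ⊩ φ
ρ ⊩ φ ∧ᶠ ψ    = ρ ⊩ φ × ρ ⊩ ψ
ρ ⊩ φ ∨ᶠ ψ    = ρ ⊩ φ ⊎ ρ ⊩ ψ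
ρ ⊩ ∀ᶠ i φ    = ∀ n → n ≤ lookup ρ i → n ∷ ρ ⊩ φ
ρ ⊩ ∃ᶠ i φ    = ∃ λ n → n ≤ lookup ρ i × n ∷ ρ ⊩ φ
ρ ⊩ reindex is φ = select ρ is ⊩ φ

-- The bound variable of a quantifier is named by the number of variables in scope.

trT : ∀ {k} → Tm k → Vec Term k → Term
trT (v i)   σ = lookup σ i
trT (lit n) σ = num n
trT (s t)   σ = S (trT t σ)

tr : ∀ {k} → Fm k → Vec Term k → Formula
tr (t ≈ u)     σ = trT t σ ≐ trT u σ
tr (t ≤ᶠ u)    σ = trT t σ ≼ trT u σ
tr (add t u w) σ = A (trT t σ) (trT u σ) (trT w σ)
tr (mul t u w) σ = M (trT t σ) (trT u σ) (trT w σ)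
tr (¬ᶠ φ)      σ = ¬′ (tr φ σ)
tr (φ ∧ᶠ ψ)    σ = tr φ σ ∧′ tr ψ σ
tr (φ ∨ᶠ ψ)    σ = tr φ σ ∨′ tr ψ σ
tr {k} (∀ᶠ i φ) σ = ∀′ k ((¬′ (var k ≼ lookup σ i)) ∨′ tr φ (var k ∷ σ))
tr {k} (∃ᶠ i φ) σ = ∃′ k ((var k ≼ lookup σ i) ∧′ tr φ (var k ∷ σ))
tr (reindex is φ) σ = tr φ (select σ is)

-- All names in scope stay below `k`, so the quantified variable `k` differs from the variable
-- bounding it.
tr-Δ₀ : ∀ {k} (φ : Fm k) {xs} → All (_< k) xs → Δ₀ (tr φ (map var xs))
tr-Δ₀ (t ≈ u)     b = d-eq _ _
tr-Δ₀ (t ≤ᶠ u)    b = d-le _ _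
tr-Δ₀ (add t u w) b = d-A _ _ _
tr-Δ₀ (mul t u w) b = d-M _ _ _
tr-Δ₀ (¬ᶠ φ)      b = d-⇒ (tr-Δ₀ φ b) d-⊥
tr-Δ₀ (φ ∧ᶠ ψ)    b = d-∧ (tr-Δ₀ φ b) (tr-Δ₀ ψ b)
tr-Δ₀ (φ ∨ᶠ ψ)    b = d-∨ (tr-Δ₀ φ b) (tr-Δ₀ ψ b)
tr-Δ₀ {k} (∀ᶠ i φ) {xs} b rewrite lookup-map i var xs =
  d-∀≤ k (lookup xs i) (<⇒≢ (All.lookup⁺ b i) ∘ sym)
    (tr-Δ₀ φ (n<1+n k ∷ All.map m<n⇒m<1+n b))
tr-Δ₀ {k} (∃ᶠ i φ) {xs} b rewrite lookup-map i var xs =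
  d-∃≤ k (lookup xs i) (<⇒≢ (All.lookup⁺ b i) ∘ sym)
    (tr-Δ₀ φ (n<1+n k ∷ All.map m<n⇒m<1+n b))
tr-Δ₀ (reindex is φ) {xs} b rewrite select-map var xs is = tr-Δ₀ φ (All.map⁺ (All.universal (All.lookup⁺ b) is))

_[_/_]ˢ : ∀ {k} → Vec Term k → Term → ℕ → Vec Term k
σ [ t / x ]ˢ = map (_[ t / x ]ₜ) σ

num-subst : ∀ n t x → (num n [ t / x ]ₜ) ≡ num n
num-subst zero    t x = refl
num-subst (suc n) t x = cong S (num-subst n t x)

num-closed : ∀ n {x} → ¬ OccT x (num n)
num-closed (suc n) (inS o) = num-closed n o

trT-subst : ∀ {k} (u : Tm k) σ t x → (trT u σ [ t / x ]ₜ) ≡ trT u (σ [ t / x ]ˢ)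
trT-subst (v i)   σ t x = sym (lookup-map i (_[ t / x ]ₜ) σ)
trT-subst (lit n) σ t x = num-subst n t x
trT-subst (s u)   σ t x = cong S (trT-subst u σ t x)

var-subst-hit : ∀ x t → (var x [ t / x ]ₜ) ≡ t
var-subst-hit x t rewrite ≡ᵇ-refl x = refl

var-subst-miss : ∀ {x y} t → x ≢ y → (var y [ t / x ]ₜ) ≡ var y
var-subst-miss {x} {y} t x≢y rewrite ≢⇒≡ᵇ-false x y x≢y = refl

subst-vacuous : ∀ t {z x u} → z ≢ x → ((t [ var x / z ]ₜ) [ u / z ]ₜ) ≡ (t [ var x / z ]ₜ)
subst-vacuous (var y) {z} {x} {u} z≢x with z ≡ᵇ y in eq
... | true  = var-subst-miss u z≢x
... | false rewrite eq = refl
subst-vacuous zer     z≢x = refl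
subst-vacuous (S t)   z≢x = cong S (subst-vacuous t z≢x)

-- The names bound in `tr φ` are at least `k`, so a substitution for `x < k` passes under every
-- quantifier and acts on the context alone.
tr-subst : ∀ {k} (φ : Fm k) σ t {x} → x < k → (tr φ σ [ t / x ]) ≡ tr φ (σ [ t / x ]ˢ)
tr-subst (u ≈ w)     σ t {x} x<k = cong₂ _≐_ (trT-subst u σ t x) (trT-subst w σ t x)
tr-subst (u ≤ᶠ w)    σ t {x} x<k = cong₂ _≼_ (trT-subst u σ t x) (trT-subst w σ t x)
tr-subst (add u w z) σ t {x} x<k = cong₃ A (trT-subst u σ t x) (trT-subst w σ t x) (trT-subst z σ t x)
tr-subst (mul u w z) σ t {x} x<k = cong₃ M (trT-subst u σ t x) (trT-subst w σ t x) (trT-subst z σ t x)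
tr-subst (¬ᶠ φ)      σ t x<k = cong ¬′_ (tr-subst φ σ t x<k)
tr-subst (φ ∧ᶠ ψ)    σ t x<k = cong₂ _∧′_ (tr-subst φ σ t x<k) (tr-subst ψ σ t x<k)
tr-subst (φ ∨ᶠ ψ)    σ t x<k = cong₂ _∨′_ (tr-subst φ σ t x<k) (tr-subst ψ σ t x<k)
tr-subst {k} (∀ᶠ i φ) σ t {x} x<k
  rewrite ≢⇒≡ᵇ-false x k (<⇒≢ x<k) | lookup-map i (_[ t / x ]ₜ) σ | tr-subst φ (var k ∷ σ) t (m<n⇒m<1+n x<k)
        -- Rewriting with the induction hypothesis reintroduces `var k [ t / x ]ₜ`, and with it the
        -- test removed before.
        | ≢⇒≡ᵇ-false x k (<⇒≢ x<k) = refl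
tr-subst {k} (∃ᶠ i φ) σ t {x} x<k
  rewrite ≢⇒≡ᵇ-false x k (<⇒≢ x<k) | lookup-map i (_[ t / x ]ₜ) σ | tr-subst φ (var k ∷ σ) t (m<n⇒m<1+n x<k)
        | ≢⇒≡ᵇ-false x k (<⇒≢ x<k) = refl
tr-subst (reindex is φ) σ t {x} x<k
  rewrite tr-subst φ (select σ is) t x<k | select-map (_[ t / x ]ₜ) σ is = refl

tr-substitutable : ∀ {k} (φ : Fm k) σ {t} x → (∀ y → k ≤ y → ¬ OccT y t) → Substitutable t x (tr φ σ)
tr-substitutable (u ≈ w)     σ x fr = tt
tr-substitutable (u ≤ᶠ w)    σ x fr = tt
tr-substitutable (add u w z) σ x fr = tt
tr-substitutable (mul u w z) σ x fr = tt
tr-substitutable (¬ᶠ φ)      σ x fr = tr-substitutable φ σ x fr , tt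
tr-substitutable (φ ∧ᶠ ψ)    σ x fr = tr-substitutable φ σ x fr , tr-substitutable ψ σ x fr
tr-substitutable (φ ∨ᶠ ψ)    σ x fr = tr-substitutable φ σ x fr , tr-substitutable ψ σ x fr
tr-substitutable {k} (∀ᶠ i φ) σ x fr =
  inj₂ (fr k ≤-refl , (tt , tt) , tr-substitutable φ (var k ∷ σ) x (λ y → fr y ∘ <⇒≤))
tr-substitutable {k} (∃ᶠ i φ) σ x fr =
  inj₂ (fr k ≤-refl , tt , tr-substitutable φ (var k ∷ σ) x (λ y → fr y ∘ <⇒≤))
tr-substitutable (reindex is φ) σ x fr = tr-substitutable φ (select σ is) x fr

num-substitutable : ∀ n x φ → Substitutable (num n) x φ
num-substitutable n x (t ≐ u)   = tt
num-substitutable n x (t ≼ u)   = tt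
num-substitutable n x (A _ _ _) = tt
num-substitutable n x (M _ _ _) = tt
num-substitutable n x ⊥′        = tt
num-substitutable n x (φ ⇒ ψ)   = num-substitutable n x φ , num-substitutable n x ψ
num-substitutable n x (φ ∧′ ψ)  = num-substitutable n x φ , num-substitutable n x ψ
num-substitutable n x (φ ∨′ ψ)  = num-substitutable n x φ , num-substitutable n x ψ
num-substitutable n x (∀′ y φ)  = inj₂ (num-closed n , num-substitutable n x φ)
num-substitutable n x (∃′ y φ)  = inj₂ (num-closed n , num-substitutable n x φ)

nums : ∀ {k} → Vec ℕ k → Vec Term k
nums = map num

nums-subst : ∀ {k} (ρ : Vec ℕ k) t x → nums ρ [ t / x ]ˢ ≡ nums ρ
nums-subst []      t x = refl
nums-subst (n ∷ ρ) t x = cong₂ _∷_ (num-subst n t x) (nums-subst ρ t x)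

trT-nums : ∀ {k} (t : Tm k) ρ → trT t (nums ρ) ≡ num (eval ρ t)
trT-nums (v i)   ρ = lookup-map i num ρ
trT-nums (lit n) ρ = refl
trT-nums (s t)   ρ = cong S (trT-nums t ρ)

upToDisj-subst : ∀ m n x → (upToDisj (var x) n [ num m / x ]) ≡ upToDisj (num m) n
upToDisj-subst m zero x rewrite ≡ᵇ-refl x = refl
upToDisj-subst m (suc n) x
  rewrite upToDisj-subst m n x | ≡ᵇ-refl x | num-subst n (num m) x = refl

-- Derivations in a theory strengthening `R∽`

module Arithmetic {T : Theory} (str : Strengthens T R∽) where

  ax : ∀ {φ} → R∽ φ → T ⊢ φ
  ax = str _

  ∧I : ∀ {φ ψ} → T ⊢ φ → T ⊢ ψ → T ⊢ φ ∧′ ψ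
  ∧I {φ} d e = r-mp d (r-∧I (ax-id φ) (r-wk φ e))

  ∨I₁ : ∀ {φ ψ} → T ⊢ φ → T ⊢ φ ∨′ ψ
  ∨I₁ d = r-mp d (ax-∨₁ _ _)

  ∨I₂ : ∀ {φ ψ} → T ⊢ ψ → T ⊢ φ ∨′ ψ
  ∨I₂ d = r-mp d (ax-∨₂ _ _)

  ∨E : ∀ {φ ψ χ} → T ⊢ φ ∨′ ψ → T ⊢ φ ⇒ χ → T ⊢ ψ ⇒ χ → T ⊢ χ
  ∨E d e f = r-mp d (r-∨E e f)

  ⇔₁ : ∀ {φ ψ} → T ⊢ φ ⇔′ ψ → T ⊢ φ ⇒ ψ
  ⇔₁ d = r-mp d (ax-∧₁ _ _)

  ⇔₂ : ∀ {φ ψ} → T ⊢ φ ⇔′ ψ → T ⊢ ψ ⇒ φ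
  ⇔₂ d = r-mp d (ax-∧₂ _ _)

  gen : ∀ {φ} x → T ⊢ φ → T ⊢ ∀′ x φ
  -- The closed theorem `⊥′ ⇒ ⊥′` serves as the antecedent that `r-∀` demands.
  gen x d = r-mp (ax-id ⊥′) (r-∀ x (λ { (⇒ˡ ()) ; (⇒ʳ ()) }) (r-wk (⊥′ ⇒ ⊥′) d))

  inst : ∀ {φ} x t → Substitutable t x φ → T ⊢ φ → T ⊢ φ [ t / x ]
  inst x t ok d = r-mp (gen x d) (ax-∀ x _ t ok)

  inst-num : ∀ {φ} x n → T ⊢ φ → T ⊢ φ [ num n / x ]
  inst-num {φ} x n = inst x (num n) (num-substitutable n x φ)

  exI : ∀ φ x n → T ⊢ φ [ num n / x ] → T ⊢ ∃′ x φ
  exI φ x n d = r-mp d (ax-∃ x φ (num n) (num-substitutable n x φ))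

  -- A fact `P` about numbers is stored with the derivation, so that `provable` and `refutable` turn
  -- it into a theorem of `T`.
  Decided : Set → Formula → Set
  Decided P φ = (P × T ⊢ φ) ⊎ (¬ P × T ⊢ ¬′ φ)

  Decided-dec : ∀ {P φ} → Dec P → (P → T ⊢ φ) → (¬ P → T ⊢ ¬′ φ) → Decided P φ
  Decided-dec (yes p) f g = inj₁ (p , f p)
  Decided-dec (no ¬p) f g = inj₂ (¬p , g ¬p)

  provable : ∀ {P φ} → Decided P φ → P → T ⊢ φ
  provable (inj₁ (_ , d))  p = d
  provable (inj₂ (¬p , _)) p = ⊥-elim (¬p p)

  refutable : ∀ {P φ} → Decided P φ → ¬ P → T ⊢ ¬′ φ
  refutable (inj₁ (p , _)) ¬p = ⊥-elim (¬p p)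
  refutable (inj₂ (_ , d)) ¬p = d

  num-refl : ∀ n → T ⊢ num n ≐ num n
  num-refl n = inst-num 0 n (eq-refl 0)

  eq-num : ∀ m n → Decided (m ≡ n) (num m ≐ num n)
  eq-num m n = Decided-dec (m ≟ n) (λ { refl → num-refl m }) (ax ∘ ax-neq m n)

  transfer : ∀ {P Q φ ψ} → T ⊢ φ ⇒ ψ → T ⊢ ψ ⇒ φ → (Q → P) → (P → Q) → Decided P ψ → Decided Q φ
  transfer a b f g (inj₁ (p , d))  = inj₁ (g p , r-mp d b)
  transfer a b f g (inj₂ (¬p , d)) = inj₂ (¬p ∘ f , r-tr a d)

  ∨-decided : ∀ {P Q φ ψ} → Decided P φ → Decided Q ψ → Decided (P ⊎ Q) (φ ∨′ ψ)
  ∨-decided (inj₁ (p , d)) _ = inj₁ (inj₁ p , ∨I₁ d)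
  ∨-decided (inj₂ _) (inj₁ (q , e)) = inj₁ (inj₂ q , ∨I₂ e)
  ∨-decided (inj₂ (¬p , d)) (inj₂ (¬q , e)) = inj₂ ([ ¬p , ¬q ]′ , r-∨E d e)

  ∧-decided : ∀ {P Q φ ψ} → Decided P φ → Decided Q ψ → Decided (P × Q) (φ ∧′ ψ)
  ∧-decided (inj₁ (p , d)) (inj₁ (q , e)) = inj₁ ((p , q) , ∧I d e)
  ∧-decided (inj₂ (¬p , d)) _ = inj₂ (¬p ∘ proj₁ , r-¬∧ (∨I₁ d))
  ∧-decided (inj₁ _) (inj₂ (¬q , e)) = inj₂ (¬q ∘ proj₂ , r-¬∧ (∨I₂ e))

  -- The rule `r-as` yields the double negation of `φ` once `φ` itself is derived; no implication
  -- between the two is involved.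
  ¬-decided : ∀ {P φ} → Decided P φ → Decided (¬ P) (¬′ φ)
  ¬-decided (inj₁ (p , d))  = inj₂ ((λ ¬p → ¬p p) , r-as ⊥′ d)
  ¬-decided (inj₂ (¬p , d)) = inj₁ (¬p , d)

  upToDisj-decided : ∀ m n → Decided (m ≤ n) (upToDisj (num m) n)
  upToDisj-decided m zero =
    transfer (ax-id _) (ax-id _) n≤0⇒n≡0 (λ { refl → z≤n }) (eq-num m 0)
  upToDisj-decided m (suc n) =
    transfer (ax-id _) (ax-id _) (λ p → Sum.map₁ (λ { (s≤s q) → q }) (m≤n⇒m<n∨m≡n p)) [ m≤n⇒m≤1+n , ≤-reflexive ]′
      (∨-decided (upToDisj-decided m n) (eq-num m (suc n)))

  le-num : ∀ m n → Decided (m ≤ n) (num m ≼ num n)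
  le-num m n = transfer (⇔₁ ax′) (⇔₂ ax′) (λ p → p) (λ p → p) (upToDisj-decided m n)
    where
      ax′ : T ⊢ (num m ≼ num n) ⇔′ upToDisj (num m) n
      ax′ = subst₂ (λ t φ → T ⊢ (num m ≼ t) ⇔′ φ) (num-subst n _ 0) (upToDisj-subst m n 0)
              (inst-num 0 m (ax (ax-le 0 n)))

  graph-num : ∀ {φ k} n → T ⊢ φ ⇔′ (num k ≐ num n) → Decided (k ≡ n) φ
  graph-num {k = k} n d = transfer (⇔₁ d) (⇔₂ d) (λ p → p) (λ p → p) (eq-num k n)

  A-num : ∀ l m n → Decided (l + m ≡ n) (A (num l) (num m) (num n))
  A-num l m n = graph-num n ax′
    where
      ax′ : T ⊢ A (num l) (num m) (num n) ⇔′ (num (l + m) ≐ num n)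
      ax′ = subst₂ (λ φ ψ → T ⊢ φ ⇔′ ψ)
              (cong₂ (λ t u → A t u (num n)) (num-subst l _ 0) (num-subst m _ 0))
              (cong (_≐ num n) (num-subst (l + m) _ 0))
              (inst-num 0 n (ax (ax-A 0 l m)))

  M-num : ∀ l m n → Decided (l * m ≡ n) (M (num l) (num m) (num n))
  M-num l m n = graph-num n ax′
    where
      ax′ : T ⊢ M (num l) (num m) (num n) ⇔′ (num (l * m) ≐ num n)
      ax′ = subst₂ (λ φ ψ → T ⊢ φ ⇔′ ψ)
              (cong₂ (λ t u → M t u (num n)) (num-subst l _ 0) (num-subst m _ 0))
              (cong (_≐ num n) (num-subst (l * m) _ 0))
              (inst-num 0 n (ax (ax-M 0 l m)))

  -- The axiom `ax-le` makes a numeral bound a finite disjunction of equations.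
  ≼-cases : ∀ x n {χ} → (∀ i → i ≤ n → T ⊢ var x ≐ num i ⇒ χ) → T ⊢ var x ≼ num n ⇒ χ
  ≼-cases x n {χ} h = r-tr (⇔₁ (ax (ax-le x n))) (disj n h)
    where
      disj : ∀ n → (∀ i → i ≤ n → T ⊢ var x ≐ num i ⇒ χ) → T ⊢ upToDisj (var x) n ⇒ χ
      disj zero    h = h 0 ≤-refl
      disj (suc n) h = r-∨E (disj n (λ i → h i ∘ m≤n⇒m≤1+n)) (h (suc n) ≤-refl)

  var≐num-sym : ∀ {z x} i → z ≢ x → T ⊢ var x ≐ num i ⇒ num i ≐ var x
  var≐num-sym {z} {x} i z≢x = subst₂ (λ t u → T ⊢ t ≐ u ⇒ u ≐ t)
    (var-subst-miss (num i) z≢x) (var-subst-hit z (num i)) (inst-num z i (eq-sym x z))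

  -- The variable z marks the positions at which num i is to be replaced by var x.
  leibniz : ∀ {k} (φ : Fm k) σ {z x} i → z < k → x < k → z ≢ x →
            T ⊢ tr φ (σ [ num i / z ]ˢ) → T ⊢ var x ≐ num i ⇒ tr φ (σ [ var x / z ]ˢ)
  leibniz {k} φ σ {z} {x} i z<k x<k z≢x d =
    -- `sub` gives an implication under the hypothesis; `r-as` applied to `d` discharges its
    -- antecedent there, in place of modus ponens under a hypothesis.
    r-tr (var≐num-sym i z≢x) (r-tr sub (r-as (tr φ (σ [ var x / z ]ˢ)) d))
    where
      σₓ = σ [ var x / z ]ˢ
      eq : T ⊢ var z ≐ var x ⇒ (tr φ σ ⇒ tr φ σₓ)
      eq = subst (λ ψ → T ⊢ var z ≐ var x ⇒ (tr φ σ ⇒ ψ)) (tr-subst φ σ (var x) z<k)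
             (eq-sub z x (tr φ σ) (tr-substitutable φ σ z λ { y k≤y here → <⇒≱ x<k k≤y }))
      -- After `z` has become `x`, no `z` is left for the numeral to replace.
      keep : tr φ σₓ [ num i / z ] ≡ tr φ σₓ
      keep = trans (tr-subst φ σₓ (num i) z<k)
        (cong (tr φ) (trans (sym (map-∘ _ _ σ)) (map-cong (λ t → subst-vacuous t z≢x) σ)))
      sub : T ⊢ num i ≐ var x ⇒ (tr φ (σ [ num i / z ]ˢ) ⇒ tr φ σₓ)
      sub = subst₂ (λ t ψ → T ⊢ t ⇒ ψ)
              (cong₂ _≐_ (var-subst-hit z (num i)) (var-subst-miss (num i) z≢x))
              (cong₂ _⇒_ (tr-subst φ σ (num i) z<k) keep)
              (inst-num z i eq)

  -- Variable `0` is the marker: it differs from `suc k`, and the closed numerals of `ρ` ignore it.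
  -- The scope has at least two variables because a quantifier is bounded by one already in scope.
  leibniz-head : ∀ {k} (φ : Fm (2 + k)) ρ i → T ⊢ tr φ (num i ∷ nums ρ) →
                 T ⊢ var (suc k) ≐ num i ⇒ tr φ (var (suc k) ∷ nums ρ)
  leibniz-head {k} φ ρ i d =
    subst (λ σ → T ⊢ var (suc k) ≐ num i ⇒ tr φ (var (suc k) ∷ σ)) (nums-subst ρ _ 0)
      (leibniz φ (var 0 ∷ nums ρ) i (s≤s z≤n) (n<1+n (suc k)) 0≢1+n
        (subst (λ σ → T ⊢ tr φ (num i ∷ σ)) (sym (nums-subst ρ _ 0)) d))

  tr-inst : ∀ {k} (φ : Fm (suc k)) ρ n → tr φ (var k ∷ nums ρ) [ num n / k ] ≡ tr φ (num n ∷ nums ρ)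
  tr-inst {k} φ ρ n = trans (tr-subst φ _ (num n) (n<1+n k))
    (cong (tr φ) (cong₂ _∷_ (var-subst-hit k (num n)) (nums-subst ρ _ k)))

  bounded-search : ∀ {P Q : ℕ → Set} → (∀ i → P i ⊎ Q i) → ∀ n →
                   (∃ λ i → i ≤ n × P i) ⊎ (∀ i → i ≤ n → Q i)
  bounded-search dec zero with dec 0
  ... | inj₁ p = inj₁ (0 , z≤n , p)
  ... | inj₂ q = inj₂ λ { .0 z≤n → q }
  bounded-search dec (suc n) with bounded-search dec n | dec (suc n)
  ... | inj₁ (i , i≤n , p) | _      = inj₁ (i , m≤n⇒m≤1+n i≤n , p)
  ... | inj₂ _             | inj₁ p = inj₁ (suc n , ≤-refl , p)
  ... | inj₂ qs            | inj₂ q = inj₂ λ i i≤ → [ (λ { (s≤s i≤n) → qs i i≤n }) , (λ { refl → q }) ]′ (m≤n⇒m<n∨m≡n i≤)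

  -- Induction on `φ`; at a quantifier the values up to the bound are searched. If the search finds
  -- nothing, `ax-dec` splits on whether `x` is below the bound: the first case is settled numeral
  -- by numeral with Leibniz's law, the second is a disjunct of the goal.
  decided : ∀ {k} (φ : Fm k) ρ → Decided (ρ ⊩ φ) (tr φ (nums ρ))
  decided (t ≈ u) ρ rewrite trT-nums t ρ | trT-nums u ρ = eq-num _ _
  decided (t ≤ᶠ u) ρ rewrite trT-nums t ρ | trT-nums u ρ = le-num _ _
  decided (add t u w) ρ rewrite trT-nums t ρ | trT-nums u ρ | trT-nums w ρ = A-num _ _ _
  decided (mul t u w) ρ rewrite trT-nums t ρ | trT-nums u ρ | trT-nums w ρ = M-num _ _ _
  decided (¬ᶠ φ) ρ = ¬-decided (decided φ ρ)
  decided (φ ∧ᶠ ψ) ρ = ∧-decided (decided φ ρ) (decided ψ ρ)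
  decided (φ ∨ᶠ ψ) ρ = ∨-decided (decided φ ρ) (decided ψ ρ)
  decided {suc k} (∀ᶠ i φ) ρ rewrite lookup-map i num ρ
    with bounded-search (λ n → Sum.swap (decided φ (n ∷ ρ))) (lookup ρ i)
  -- The instance at the counterexample `n` is a disjunction with both members refuted.
  ... | inj₁ (n , n≤ , ¬p , d) = inj₂ ((λ p → ¬p (p n n≤)) , r-tr instance′
          (r-∨E (r-as ⊥′ (provable (le-num n (lookup ρ i)) n≤)) d))
    where
      body = (¬′ (var (suc k) ≼ num (lookup ρ i))) ∨′ tr φ (var (suc k) ∷ nums ρ)
      instance′ : T ⊢ ∀′ (suc k) body ⇒ (¬′ (num n ≼ num (lookup ρ i))) ∨′ tr φ (num n ∷ nums ρ)
      instance′ = subst₂ (λ χ ψ → T ⊢ ∀′ (suc k) body ⇒ (¬′ χ) ∨′ ψ)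
        (cong₂ _≼_ (var-subst-hit (suc k) (num n)) (num-subst (lookup ρ i) _ (suc k)))
        (tr-inst φ ρ n)
        (ax-∀ (suc k) body (num n) (num-substitutable n (suc k) body))
  ... | inj₂ all′ = inj₁ ((λ n n≤ → proj₁ (all′ n n≤)) , gen (suc k) (∨E (ax (ax-dec (suc k) (lookup ρ i)))
          (r-tr (≼-cases (suc k) (lookup ρ i) (λ j j≤ → leibniz-head φ ρ j (proj₂ (all′ j j≤)))) (ax-∨₂ _ _))
          (ax-∨₁ _ _)))
  decided {suc k} (∃ᶠ i φ) ρ rewrite lookup-map i num ρ
    with bounded-search (λ n → decided φ (n ∷ ρ)) (lookup ρ i)
  ... | inj₁ (n , n≤ , p , d) = inj₁ ((n , n≤ , p) , exI _ (suc k) n (subst₂ (λ χ ψ → T ⊢ χ ∧′ ψ)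
        (sym (cong₂ _≼_ (var-subst-hit (suc k) (num n)) (num-subst (lookup ρ i) _ (suc k))))
        (sym (tr-inst φ ρ n))
        (∧I (provable (le-num n (lookup ρ i)) n≤) d)))
  ... | inj₂ none = inj₂ ((λ (n , n≤ , p) → proj₁ (none n n≤) p) ,
        -- Here the disjunction consists of negations, and `r-¬∧` turns it into the negated matrix.
        r-∃ (suc k) (λ ()) (r-¬∧ (∨E (ax (ax-dec (suc k) (lookup ρ i)))
          (r-tr (≼-cases (suc k) (lookup ρ i) (λ j j≤ → leibniz-head (¬ᶠ φ) ρ j (proj₂ (none j j≤)))) (ax-∨₂ _ _))
          (ax-∨₁ _ _))))
  decided (reindex is φ) ρ rewrite select-map num ρ is = decided φ (select ρ is)

-- Coding finite sets of numbers by divisibility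

-- The moduli of Gödel's β-function; for `d = N !` they are pairwise coprime at positions up to `N`.
modulus : ℕ → ℕ → ℕ
modulus d p = suc (suc p * d)

≤⇒∣! : ∀ {m n} → 0 < m → m ≤ n → m ∣ n !
≤⇒∣! {suc m} _ m≤n = ∣-trans (m∣m*n (m !)) (m≤n⇒m!∣n! m≤n)

-- A common divisor `g` divides the difference `(q ∸ p) * d`. It is coprime to `d`, since a modulus
-- is 1 modulo `d`; so it divides `q ∸ p`, hence `N !`, and equals 1.
modulus-coprime-< : ∀ {N p q} → p < q → q ≤ N → Coprime (modulus (N !) p) (modulus (N !) q)
modulus-coprime-< {N} {p} {q} p<q q≤N {g} (g∣p , g∣q) = coprime-d g∣d g∣p
  where
    d = N !
    δ = q ∸ p
    coprime-d : ∀ {h} → h ∣ d → h ∣ modulus d p → h ≡ 1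
    coprime-d {h} h∣d h∣p = ∣1⇒≡1 (∣m+n∣m⇒∣n (subst (h ∣_) (+-comm 1 (suc p * d)) h∣p) (∣n⇒∣m*n (suc p) h∣d))
    split : modulus d q ≡ modulus d p + δ * d
    split = cong suc (trans (cong (λ x → suc x * d) (sym (m+[n∸m]≡n (<⇒≤ p<q)))) (*-distribʳ-+ d (suc p) δ))
    g∣δd : g ∣ d * δ
    g∣δd = subst (g ∣_) (*-comm δ d) (∣m+n∣m⇒∣n (subst (g ∣_) split g∣q) g∣p)
    g∣δ : g ∣ δ
    g∣δ = coprime-divisor (λ (h∣g , h∣d) → coprime-d h∣d (∣-trans h∣g g∣p)) g∣δd
    g∣d : g ∣ d
    g∣d = ∣-trans g∣δ (≤⇒∣! (m<n⇒0<n∸m p<q) (≤-trans (m∸n≤m q p) q≤N))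

modulus-coprime : ∀ {N p q} → p ≢ q → p ≤ N → q ≤ N → Coprime (modulus (N !) p) (modulus (N !) q)
modulus-coprime {p = p} {q} p≢q p≤N q≤N with <-cmp p q
... | tri< p<q _ _ = modulus-coprime-< p<q q≤N
... | tri≈ _ p≡q _ = ⊥-elim (p≢q p≡q)
... | tri> _ _ q<p = Coprimality.sym (modulus-coprime-< q<p p≤N)

setCode : ℕ → List ℕ → ℕ
setCode d ps = product (List.map (modulus d) ps)

∈⇒modulus∣ : ∀ {d p ps} → p ∈ ps → modulus d p ∣ setCode d ps
∈⇒modulus∣ p∈ps = ∈⇒∣product (∈-map⁺ _ p∈ps)

-- A modulus coprime to the head factor must divide the remaining product, and no modulus divides
-- the empty product.
modulus∣⇒∈ : ∀ {N p} ps → p ≤ N → (∀ {q} → q ∈ ps → q ≤ N) → modulus (N !) p ∣ setCode (N !) ps → p ∈ ps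
modulus∣⇒∈ {N} {p} [] p≤N ps≤N m∣1 =
  ⊥-elim (<⇒≢ (*-mono-≤ {1} {suc p} (s≤s z≤n) (1≤n! N)) (sym (suc-injective (∣1⇒≡1 m∣1))))
modulus∣⇒∈ {p = p} (q ∷ ps) p≤N ps≤N m∣c with p ≟ q
... | yes refl = here refl
... | no p≢q = there (modulus∣⇒∈ ps p≤N (ps≤N ∘ there)
                 (coprime-divisor (modulus-coprime p≢q p≤N (ps≤N (here refl))) m∣c))

setCode-nonZero : ∀ d ps → NonZero (setCode d ps)
setCode-nonZero d ps = product≢0 (ListAll.map⁺ (ListAll.universal (λ _ → _) ps))

-- A pair with `r ≤ e` is written in base `suc e` with last digit `r`, which is injective.
pos : ℕ → ℕ → ℕ → ℕ
pos e i r = i * suc e + r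

pos-mono-< : ∀ {e i r i′ r′} → i < i′ → r ≤ e → pos e i r < pos e i′ r′
pos-mono-< {e} {i} {r} {i′} {r′} i<i′ r≤e = begin-strict
  i * suc e + r      <⟨ +-monoʳ-< (i * suc e) (s≤s r≤e) ⟩
  i * suc e + suc e  ≡⟨ +-comm (i * suc e) (suc e) ⟩
  suc i * suc e      ≤⟨ *-monoˡ-≤ (suc e) i<i′ ⟩
  i′ * suc e         ≤⟨ m≤m+n _ r′ ⟩
  i′ * suc e + r′    ∎ where open ≤-Reasoning

pos-injective : ∀ {e i r i′ r′} → r ≤ e → r′ ≤ e → pos e i r ≡ pos e i′ r′ → (i , r) ≡ (i′ , r′)
pos-injective {e} {i} {r} {i′} {r′} r≤e r′≤e eq with <-cmp i i′
... | tri< i<i′ _ _ = ⊥-elim (<⇒≢ (pos-mono-< i<i′ r≤e) eq)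
... | tri> _ _ i′<i = ⊥-elim (<⇒≢ (pos-mono-< i′<i r′≤e) (sym eq))
... | tri≈ _ refl _ = cong (i ,_) (+-cancelˡ-≡ (i * suc e) r r′ eq)

-- Bounded formulas for the graphs of recursive functions

ren : ∀ {k l} → (Fin k → Fin l) → Tm k → Tm l
ren f (v i)   = v (f i)
ren f (lit n) = lit n
ren f (s t)   = s (ren f t)

wk : ∀ n {k} → Tm k → Tm (n + k)
wk n = ren (n ↑ʳ_)

eval-wk : ∀ {n k} (ws : Vec ℕ n) (ρ : Vec ℕ k) t → eval (ws ++ ρ) (wk n t) ≡ eval ρ t
eval-wk ws ρ (v i)   = lookup-++ʳ ws ρ i
eval-wk ws ρ (lit n) = refl
eval-wk ws ρ (s t)   = cong suc (eval-wk ws ρ t)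

evals : ∀ {n k} → Vec ℕ k → Vec (Tm k) n → Vec ℕ n
evals ρ = map (eval ρ)

wks : ∀ j {n k} → Vec (Tm k) n → Vec (Tm (j + k)) n
wks j = map (wk j)

evals-wks : ∀ {j n k} (ws : Vec ℕ j) (ρ : Vec ℕ k) (ts : Vec (Tm k) n) → evals (ws ++ ρ) (wks j ts) ≡ evals ρ ts
evals-wks ws ρ ts = trans (sym (map-∘ _ _ ts)) (map-cong (eval-wk ws ρ) ts)

∃ᶠ* : ∀ j {k} → Fin k → Fm (j + k) → Fm k
∃ᶠ* zero    b φ = φ
∃ᶠ* (suc j) b φ = ∃ᶠ* j b (∃ᶠ (j ↑ʳ b) φ)

⊩∃ᶠ* : ∀ j {k} (b : Fin k) φ ρ →
       ρ ⊩ ∃ᶠ* j b φ ⇔ (∃ λ ws → All (_≤ lookup ρ b) ws × (ws ++ ρ) ⊩ φ)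
⊩∃ᶠ* zero b φ ρ = mk⇔ (λ p → [] , [] , p) λ { ([] , [] , p) → p }
⊩∃ᶠ* (suc j) b φ ρ = mk⇔ to from
  where
    module IH = Equivalence (⊩∃ᶠ* j b (∃ᶠ (j ↑ʳ b) φ) ρ)
    to : ρ ⊩ ∃ᶠ* (suc j) b φ → _
    to p with IH.to p
    ... | ws , ws≤ , n , n≤ , q = n ∷ ws , subst (n ≤_) (lookup-++ʳ ws ρ b) n≤ ∷ ws≤ , q
    from : _ → ρ ⊩ ∃ᶠ* (suc j) b φ
    from (n ∷ ws , n≤ ∷ ws≤ , q) = IH.from (ws , ws≤ , n , subst (n ≤_) (sym (lookup-++ʳ ws ρ b)) n≤ , q)

newVars : ∀ j {k} → Vec (Tm (j + k)) j
newVars j {k} = tabulate (λ i → v (i ↑ˡ k))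

evals-newVars : ∀ {j k} (ws : Vec ℕ j) (ρ : Vec ℕ k) → evals (ws ++ ρ) (newVars j) ≡ ws
evals-newVars {j} {k} ws ρ = begin
  evals (ws ++ ρ) (newVars j)                     ≡⟨ tabulate-∘ (eval (ws ++ ρ)) (λ i → v (i ↑ˡ k)) ⟨
  tabulate (λ i → lookup (ws ++ ρ) (i ↑ˡ k))      ≡⟨ tabulate-cong (lookup-++ˡ ws ρ) ⟩
  tabulate (lookup ws)                            ≡⟨ tabulate∘lookup ws ⟩
  ws                                              ∎ where open ≡-Reasoning

#0 : ∀ {k} → Fin (1 + k)
#0 = zero
#1 : ∀ {k} → Fin (2 + k)
#1 = suc #0
#2 : ∀ {k} → Fin (3 + k)
#2 = suc #1
#3 : ∀ {k} → Fin (4 + k)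
#3 = suc #2
#4 : ∀ {k} → Fin (5 + k)
#4 = suc #3
#5 : ∀ {k} → Fin (6 + k)
#5 = suc #4
#6 : ∀ {k} → Fin (7 + k)
#6 = suc #5

-- `modulus d (pos e i r) ∣ c`, with the intermediate values and the quotient bounded by b.
member : ∀ {k} (i r c d e b : Fin k) → Fm k
member i r c d e b =
  ∃ᶠ b (mul (v (suc i)) (s (v (suc e))) (v #0) ∧ᶠ
  ∃ᶠ (suc b) (add (v #1) (v (2 ↑ʳ r)) (v #0) ∧ᶠ
  ∃ᶠ (2 ↑ʳ b) (mul (s (v #1)) (v (3 ↑ʳ d)) (v #0) ∧ᶠ
  ∃ᶠ (3 ↑ʳ b) (mul (v #0) (s (v #1)) (v (4 ↑ʳ c))))))

module _ {k} (ρ : Vec ℕ k) (i r c d e b : Fin k) where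
  private
    val = lookup ρ

  member⇒∣ : ρ ⊩ member i r c d e b → modulus (val d) (pos (val e) (val i) (val r)) ∣ val c
  member⇒∣ (_ , _ , refl , _ , _ , refl , _ , _ , refl , q , _ , eq) = divides q (sym eq)

  -- The intermediate values are at most the modulus because `d` is nonzero; the modulus and the
  -- quotient are at most `c` as divisors of a nonzero number.
  ∣⇒member : .{{_ : NonZero (val c)}} → .{{_ : NonZero (val d)}} → val c ≤ val b →
             modulus (val d) (pos (val e) (val i) (val r)) ∣ val c → ρ ⊩ member i r c d e b
  ∣⇒member c≤b m∣c@(divides q eq) =
    _ , ≤-trans (m≤m+n _ _) p≤b , refl ,
    _ , p≤b , refl ,
    _ , ≤-trans (n≤1+n _) m≤b , refl ,
    q , ≤-trans (∣⇒≤ (divides (modulus (val d) p) (trans eq (*-comm q _)))) c≤b , sym eq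
    where
      p = pos (val e) (val i) (val r)
      m≤b : modulus (val d) p ≤ val b
      m≤b = ≤-trans (∣⇒≤ m∣c) c≤b
      p≤b : p ≤ val b
      p≤b = ≤-trans (≤-trans (n≤1+n p) (≤-trans (m≤m*n (suc p) (val d)) (n≤1+n _))) m≤b

-- The triple (c , d , e) in the clause for prec codes a set of pairs (i , r), each of which must be justified
-- by the base case or by a predecessor in the set; this already forces r to be the value at i, so the
-- pairs need not form a functional sequence.
mutual
  graph : ∀ {n k} → Rec n → Vec (Tm k) n → Tm k → Fin k → Fm k
  graph zeroF    []       y b = lit 0 ≈ y
  graph succF    (x ∷ []) y b = s x ≈ y
  graph (proj i) xs       y b = lookup xs i ≈ y
  graph (comp {j} f gs) xs y b =
    ∃ᶠ* j b (graphs gs (wks j xs) (newVars j) (j ↑ʳ b) ∧ᶠ graph f (newVars j) (wk j y) (j ↑ʳ b))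
  graph (prec f g) (x ∷ xs) y b =
    -- These bind c, d, e. In the scope of five, indices count r, i, e, d, c from 0; the last two
    -- quantifiers put r′, i′ in front.
    ∃ᶠ b (∃ᶠ (suc b) (∃ᶠ (2 ↑ʳ b) (
      ∃ᶠ #0 (∃ᶠ #1 (v #1 ≈ wk 5 x ∧ᶠ v #0 ≈ wk 5 y ∧ᶠ member #1 #0 #4 #3 #2 (5 ↑ʳ b))) ∧ᶠ
      ∀ᶠ #0 (∀ᶠ #1 (¬ᶠ member #1 #0 #4 #3 #2 (5 ↑ʳ b) ∨ᶠ
        (v #1 ≈ lit 0 ∧ᶠ graph f (wks 5 xs) (v #0) (5 ↑ʳ b)) ∨ᶠ
        ∃ᶠ #2 (∃ᶠ #3 (v #3 ≈ s (v #1) ∧ᶠ member #1 #0 #6 #5 #4 (7 ↑ʳ b) ∧ᶠ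
          graph g (v #1 ∷ v #0 ∷ wks 7 xs) (v #2) (7 ↑ʳ b))))))))
  graph (mu f) xs y b =
    -- Bounding `y` by `b` lets the quantifier below reach every `z < y`.
    y ≤ᶠ v b ∧ᶠ graph f (y ∷ xs) (lit 0) b ∧ᶠ
    ∀ᶠ b (¬ᶠ (s (v #0) ≤ᶠ wk 1 y) ∨ᶠ
      ∃ᶠ (suc b) (graph f (v #1 ∷ wks 2 xs) (s (v #0)) (2 ↑ʳ b)))

  graphs : ∀ {j n k} → Vec (Rec n) j → Vec (Tm k) n → Vec (Tm k) j → Fin k → Fm k
  graphs []       xs []       b = lit 0 ≈ lit 0
  graphs (g ∷ gs) xs (y ∷ ys) b = graph g xs y b ∧ᶠ graphs gs xs ys b

-- Soundness and completeness of the graph formulas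

mutual
  graph-sound : ∀ {n k} (f : Rec n) xs y b (ρ : Vec ℕ k) → ρ ⊩ graph f xs y b → f ⟦ evals ρ xs ⟧⇓ eval ρ y
  graph-sound zeroF    []       y b ρ p = subst (zeroF ⟦ [] ⟧⇓_) p e-zero
  graph-sound succF    (x ∷ []) y b ρ p = subst (succF ⟦ _ ⟧⇓_) p (e-succ _)
  graph-sound (proj i) xs       y b ρ p =
    subst (proj i ⟦ _ ⟧⇓_) (trans (lookup-map i (eval ρ) xs) p) (e-proj i _)
  graph-sound (comp {j} f gs) xs y b ρ p
    with Equivalence.to (⊩∃ᶠ* j b _ ρ) p
  ... | ws , _ , q , r = e-comp
        (subst₂ (gs ⟦_⟧⇓*_) (evals-wks ws ρ xs) (evals-newVars ws ρ) (graphs-sound gs _ _ _ (ws ++ ρ) q))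
        (subst₂ (f ⟦_⟧⇓_) (evals-newVars ws ρ) (eval-wk ws ρ y) (graph-sound f _ _ _ (ws ++ ρ) r))
  graph-sound (prec f g) (x ∷ xs) y b ρ (c , _ , d , _ , e , _ , (i₀ , i₀≤e , r₀ , r₀≤e , i₀≡ , r₀≡ , i₀r₀∈) , steps) =
    subst₂ (λ m z → prec f g ⟦ m ∷ evals ρ xs ⟧⇓ z)
      (trans i₀≡ (eval-wk (r₀ ∷ i₀ ∷ e ∷ d ∷ c ∷ []) ρ x))
      (trans r₀≡ (eval-wk (r₀ ∷ i₀ ∷ e ∷ d ∷ c ∷ []) ρ y))
      (correct i₀ i₀≤e r₀ r₀≤e i₀r₀∈)
    where
      -- Recursion on `i`: a justification of `(i , r)` stops at `0` or leads to a pair whose first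
      -- component is one less.
      correct : ∀ i → i ≤ e → ∀ r → r ≤ e →
                (r ∷ i ∷ e ∷ d ∷ c ∷ ρ) ⊩ member #1 #0 #4 #3 #2 (5 ↑ʳ b) → prec f g ⟦ i ∷ evals ρ xs ⟧⇓ r
      correct i i≤e r r≤e ir∈ with steps i i≤e r r≤e
      ... | inj₁ ir∉ = ⊥-elim (ir∉ ir∈)
      ... | inj₂ (inj₁ (refl , p)) = e-prec0
            (subst (f ⟦_⟧⇓ r) (evals-wks (r ∷ i ∷ e ∷ d ∷ c ∷ []) ρ xs) (graph-sound f _ _ _ _ p))
      ... | inj₂ (inj₂ (i′ , i′≤e , r′ , r′≤e , refl , i′r′∈ , p)) = e-precS
            (correct i′ i′≤e r′ r′≤e i′r′∈)
            (subst (λ X → g ⟦ i′ ∷ r′ ∷ X ⟧⇓ r) (evals-wks (r′ ∷ i′ ∷ r ∷ i ∷ e ∷ d ∷ c ∷ []) ρ xs)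
              (graph-sound g _ _ _ _ p))
  graph-sound (mu f) xs y b ρ (y≤b , p , below) = e-mu (graph-sound f _ _ _ _ p) nonzero
    where
      nonzero : ∀ z → z < eval ρ y → ∃ λ w → f ⟦ z ∷ evals ρ xs ⟧⇓ suc w
      nonzero z z<y with below z (≤-trans (<⇒≤ z<y) y≤b)
      ... | inj₁ z≮y = ⊥-elim (z≮y (subst (z <_) (sym (eval-wk (z ∷ []) ρ y)) z<y))
      ... | inj₂ (w , _ , q) =
            w , subst (λ X → f ⟦ z ∷ X ⟧⇓ suc w) (evals-wks (w ∷ z ∷ []) ρ xs) (graph-sound f _ _ _ _ q)

  graphs-sound : ∀ {j n k} (gs : Vec (Rec n) j) xs ys b (ρ : Vec ℕ k) →
                 ρ ⊩ graphs gs xs ys b → gs ⟦ evals ρ xs ⟧⇓* evals ρ ys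
  graphs-sound []       xs []       b ρ p       = []
  graphs-sound (g ∷ gs) xs (y ∷ ys) b ρ (p , q) = graph-sound g xs y b ρ p ∷ graphs-sound gs xs ys b ρ q

-- `Holds f X Y B`: the bound B already suffices to witness `f ⟦ X ⟧⇓ Y`.
Holds : ∀ {n} → Rec n → Vec ℕ n → ℕ → ℕ → Set
Holds f X Y B = ∀ {k} (ρ : Vec ℕ k) xs y b → evals ρ xs ≡ X → eval ρ y ≡ Y → B ≤ lookup ρ b → ρ ⊩ graph f xs y b

Holds* : ∀ {n j} → Vec (Rec n) j → Vec ℕ n → Vec ℕ j → ℕ → Set
Holds* gs X Y B = ∀ {k} (ρ : Vec ℕ k) xs ys b → evals ρ xs ≡ X → evals ρ ys ≡ Y → B ≤ lookup ρ b → ρ ⊩ graphs gs xs ys b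

Holds-mono : ∀ {n} (f : Rec n) {X Y B B′} → B ≤ B′ → Holds f X Y B → Holds f X Y B′
Holds-mono f B≤B′ h ρ xs y b eqs eq B′≤ = h ρ xs y b eqs eq (≤-trans B≤B′ B′≤)

module _ {n} (f : Rec n) (g : Rec (2 + n)) (X : Vec ℕ n) where

  -- The counterpart of the justification clause for `prec` in `graph`, with membership in a list
  -- instead of divisibility.
  Step : List (ℕ × ℕ) → ℕ → ℕ × ℕ → Set
  Step L B (i , r) =
    (i ≡ 0 × Holds f X r B) ⊎
    (∃₂ λ i′ r′ → i ≡ suc i′ × (i′ , r′) ∈ L × Holds g (i′ ∷ r′ ∷ X) r B)

  Step-mono : ∀ {L L′ B B′ p} → (∀ {q} → q ∈ L → q ∈ L′) → B ≤ B′ → Step L B p → Step L′ B′ p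
  Step-mono L⊆L′ B≤B′ (inj₁ (z , h)) = inj₁ (z , Holds-mono f B≤B′ h)
  Step-mono L⊆L′ B≤B′ (inj₂ (i′ , r′ , eq , q∈ , h)) = inj₂ (i′ , r′ , eq , L⊆L′ q∈ , Holds-mono g B≤B′ h)

  record Trace (m y : ℕ) : Set where
    field
      pairs : List (ℕ × ℕ)
      bound : ℕ
      last  : (m , y) ∈ pairs
      steps : ∀ {p} → p ∈ pairs → Step pairs bound p

  trace-zero : ∀ {y B} → Holds f X y B → Trace 0 y
  trace-zero {y} {B} h = record
    { pairs = (0 , y) ∷ [] ; bound = B ; last = here refl
    ; steps = λ { (here refl) → inj₁ (refl , h) ; (there ()) } }

  trace-suc : ∀ {m r y B} → Trace m r → Holds g (m ∷ r ∷ X) y B → Trace (suc m) y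
  trace-suc {m} {r} {y} {B} t h = record
    { pairs = (suc m , y) ∷ pairs ; bound = bound ⊔ B ; last = here refl
    ; steps = λ { (here refl) → inj₂ (m , r , refl , there last , Holds-mono g (m≤n⊔m bound B) h)
                ; (there p∈)  → Step-mono there (m≤m⊔n bound B) (steps p∈) } }
    where open Trace t

  pairs-bounded : ∀ (L : List (ℕ × ℕ)) → ∃ λ e → ∀ {i r} → (i , r) ∈ L → i ≤ e × r ≤ e
  pairs-bounded [] = 0 , λ ()
  pairs-bounded ((i , r) ∷ L) with pairs-bounded L
  ... | e , L≤e = i ⊔ r ⊔ e , λ
    { (here refl) → ≤-trans (m≤m⊔n i r) (m≤m⊔n (i ⊔ r) e) , ≤-trans (m≤n⊔m i r) (m≤m⊔n (i ⊔ r) e)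
    ; (there p∈)  → Prod.map (λ p → ≤-trans p (m≤n⊔m (i ⊔ r) e)) (λ p → ≤-trans p (m≤n⊔m (i ⊔ r) e)) (L≤e p∈) }

  pos-≤ : ∀ {e i r} → i ≤ e → r ≤ e → pos e i r ≤ pos e e e
  pos-≤ {e} i≤e r≤e = +-mono-≤ (*-monoˡ-≤ (suc e) i≤e) r≤e

  -- `e` bounds the entries of all pairs and `N` their positions; `d = N !` makes the moduli
  -- coprime, so among entries up to `e` the number `c` codes exactly the trace.
  trace⇒Holds : ∀ {m y} → Trace m y → ∃ (Holds (prec f g) (m ∷ X) y)
  trace⇒Holds {m} {y} t = bound ⊔ (c ⊔ (d ⊔ e)) , holds
    where
      open Trace t
      e = proj₁ (pairs-bounded pairs)
      pairs≤e : ∀ {i r} → (i , r) ∈ pairs → i ≤ e × r ≤ e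
      pairs≤e = proj₂ (pairs-bounded pairs)
      N = pos e e e
      d = N !
      ps = List.map (λ (i , r) → pos e i r) pairs
      c = setCode d ps
      instance
        c≢0 : NonZero c
        c≢0 = setCode-nonZero d ps
        d≢0 : NonZero d
        d≢0 = N !≢0
      ps≤N : ∀ {q} → q ∈ ps → q ≤ N
      ps≤N q∈ with ∈-map⁻ (λ (i , r) → pos e i r) q∈
      ... | _ , p∈ , refl = pos-≤ (proj₁ (pairs≤e p∈)) (proj₂ (pairs≤e p∈))
      ∣⇒∈ : ∀ {i r} → i ≤ e → r ≤ e → modulus d (pos e i r) ∣ c → (i , r) ∈ pairs
      ∣⇒∈ i≤e r≤e m∣c with ∈-map⁻ (λ (i , r) → pos e i r) (modulus∣⇒∈ ps (pos-≤ i≤e r≤e) ps≤N m∣c)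
      ... | _ , p∈ , eq = subst (_∈ pairs) (sym (pos-injective r≤e (proj₂ (pairs≤e p∈)) eq)) p∈
      holds : Holds (prec f g) (m ∷ X) y (bound ⊔ (c ⊔ (d ⊔ e)))
      holds ρ (x ∷ xs) y′ b refl refl B≤b =
        c , c≤b , d , ≤-trans (≤-trans (m≤m⊔n d e) (m≤n⊔m c _)) B′≤b , e , ≤-trans (≤-trans (m≤n⊔m d e) (m≤n⊔m c _)) B′≤b ,
        (m , proj₁ (pairs≤e last) , y , proj₂ (pairs≤e last) ,
         sym (eval-wk (y ∷ m ∷ e ∷ d ∷ c ∷ []) ρ x) , sym (eval-wk (y ∷ m ∷ e ∷ d ∷ c ∷ []) ρ y′) ,
         ∣⇒member (y ∷ m ∷ e ∷ d ∷ c ∷ ρ) #1 #0 #4 #3 #2 (5 ↑ʳ b) c≤b (∈⇒modulus∣ (∈-map⁺ _ last))) ,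
        step
        where
          B′≤b = ≤-trans (m≤n⊔m bound _) B≤b
          bound≤b = ≤-trans (m≤m⊔n bound _) B≤b
          c≤b = ≤-trans (m≤m⊔n c _) B′≤b
          step : ∀ i → i ≤ e → ∀ r → r ≤ e → _
          -- A non-divisor satisfies the first disjunct; a divisor comes from a pair of the trace,
          -- which `steps` justifies.
          step i i≤e r r≤e with modulus d (pos e i r) ∣? c
          ... | no m∤c = inj₁ (m∤c ∘ member⇒∣ (r ∷ i ∷ e ∷ d ∷ c ∷ ρ) #1 #0 #4 #3 #2 (5 ↑ʳ b))
          ... | yes m∣c with steps (∣⇒∈ i≤e r≤e m∣c)
          ...   | inj₁ (refl , h) = inj₂ (inj₁ (refl ,
                    h _ _ _ _ (evals-wks (r ∷ i ∷ e ∷ d ∷ c ∷ []) ρ xs) refl bound≤b))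
          ...   | inj₂ (i′ , r′ , refl , p∈ , h) = inj₂ (inj₂ (i′ , proj₁ (pairs≤e p∈) , r′ , proj₂ (pairs≤e p∈) , refl ,
                    ∣⇒member (r′ ∷ i′ ∷ r ∷ i ∷ e ∷ d ∷ c ∷ ρ) #1 #0 #6 #5 #4 (7 ↑ʳ b) c≤b (∈⇒modulus∣ (∈-map⁺ _ p∈)) ,
                    h _ _ _ _ (cong (λ Y → i′ ∷ r′ ∷ Y) (evals-wks (r′ ∷ i′ ∷ r ∷ i ∷ e ∷ d ∷ c ∷ []) ρ xs)) refl bound≤b))

uniform-bound : ∀ {P : ℕ → ℕ → Set} → (∀ {z B B′} → B ≤ B′ → P z B → P z B′) →
                ∀ y → (∀ z → z < y → ∃ (P z)) → ∃ λ B → ∀ z → z < y → P z B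
uniform-bound mono zero h = 0 , λ _ ()
uniform-bound mono (suc y) h with uniform-bound mono y (λ z → h z ∘ m<n⇒m<1+n) | h y (n<1+n y)
... | B , all′ | B′ , p = B ⊔ B′ , λ z z<1+y → [ (λ z<y → mono (m≤m⊔n B B′) (all′ z z<y)) , (λ { refl → mono (m≤n⊔m B B′) p }) ]′
                            (m≤n⇒m<n∨m≡n (≤-pred z<1+y))

vec-bounded : ∀ {n} (ws : Vec ℕ n) → ∃ λ B → All (_≤ B) ws
vec-bounded [] = 0 , []
vec-bounded (w ∷ ws) with vec-bounded ws
... | B , ws≤B = w ⊔ B , m≤m⊔n w B ∷ All.map (λ p → ≤-trans p (m≤n⊔m w B)) ws≤B

mutual
  -- Induction on the derivation, with the maximum of the bounds of subderivations and of the values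
  -- to be bounded. For `prec` the derivation is first flattened into a `Trace`.
  graph-complete : ∀ {n} {f : Rec n} {X Y} → f ⟦ X ⟧⇓ Y → ∃ (Holds f X Y)
  graph-complete e-zero = 0 , λ { ρ [] y b _ eq _ → sym eq }
  graph-complete (e-succ x) = 0 , λ { ρ (x ∷ []) y b refl eq _ → sym eq }
  graph-complete (e-proj i X) = 0 , λ { ρ xs y b refl eq _ → trans (sym (lookup-map i (eval ρ) xs)) (sym eq) }
  graph-complete (e-comp {k = j} {f = f} {gs} {X} {ws} {Y} ds d)
    with graphs-complete ds | graph-complete d | vec-bounded ws
  ... | B₁ , h₁ | B₂ , h₂ | B₃ , ws≤ = B₁ ⊔ (B₂ ⊔ B₃) , λ { ρ xs y b refl refl B≤ →
          let B′≤ = ≤-trans (m≤n⊔m B₁ _) B≤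
              b≡  = lookup-++ʳ ws ρ b
          in Equivalence.from (⊩∃ᶠ* j b _ ρ)
            ( ws , All.map (λ p → ≤-trans p (≤-trans (m≤n⊔m B₂ B₃) B′≤)) ws≤
            , h₁ (ws ++ ρ) _ _ _ (evals-wks ws ρ xs) (evals-newVars ws ρ)
                (subst (B₁ ≤_) (sym b≡) (≤-trans (m≤m⊔n B₁ _) B≤))
            , h₂ (ws ++ ρ) _ _ _ (evals-newVars ws ρ) (eval-wk ws ρ y)
                (subst (B₂ ≤_) (sym b≡) (≤-trans (m≤m⊔n B₂ B₃) B′≤))) }
  graph-complete d@(e-prec0 _)   = trace⇒Holds _ _ _ (trace d)
  graph-complete d@(e-precS _ _) = trace⇒Holds _ _ _ (trace d)
  graph-complete (e-mu {f = f} {X} {Y} d below)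
    with graph-complete d | uniform-bound
      -- The bound also covers `w`, over which the formula for `mu` quantifies.
      {P = λ z B → ∃ λ w → w ≤ B × Holds f (z ∷ X) (suc w) B}
      (λ B≤B′ (w , w≤B , h) → w , ≤-trans w≤B B≤B′ , Holds-mono f B≤B′ h) Y
      (λ z z<y → let (B , h) = graph-complete (proj₂ (below z z<y)) in
         proj₁ (below z z<y) ⊔ B , proj₁ (below z z<y) , m≤m⊔n _ B , Holds-mono f (m≤n⊔m (proj₁ (below z z<y)) B) h)
  ... | B₁ , h₁ | B₂ , h₂ = Y ⊔ (B₁ ⊔ B₂) , holds
    where
      holds : Holds (mu f) X Y (Y ⊔ (B₁ ⊔ B₂))
      holds ρ xs y b refl refl B≤ =
        ≤-trans (m≤m⊔n Y _) B≤ ,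
        h₁ ρ _ _ b refl refl (≤-trans (m≤m⊔n B₁ B₂) B′≤) ,
        minimal
        where
          B′≤ = ≤-trans (m≤n⊔m Y _) B≤
          minimal : ∀ z → z ≤ lookup ρ b → _
          minimal z z≤b with suc z ≤? Y
          ... | no z≮Y = inj₁ (z≮Y ∘ subst (z <_) (eval-wk (z ∷ []) ρ y))
          ... | yes z<Y with h₂ z z<Y
          ...   | w , w≤B₂ , h = inj₂ (w , ≤-trans w≤B₂ (≤-trans (m≤n⊔m B₁ B₂) B′≤) ,
                    h (w ∷ z ∷ ρ) _ _ _ (cong (z ∷_) (evals-wks (w ∷ z ∷ []) ρ xs)) refl
                      (≤-trans (m≤n⊔m B₁ B₂) B′≤))

  trace : ∀ {n} {f : Rec n} {g m X y} → prec f g ⟦ m ∷ X ⟧⇓ y → Trace f g X m y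
  trace (e-prec0 d)    = trace-zero _ _ _ (proj₂ (graph-complete d))
  trace (e-precS d d′) = trace-suc _ _ _ (trace d) (proj₂ (graph-complete d′))

  graphs-complete : ∀ {n j} {gs : Vec (Rec n) j} {X Y} → gs ⟦ X ⟧⇓* Y → ∃ (Holds* gs X Y)
  graphs-complete [] = 0 , λ { ρ xs [] b _ _ _ → refl }
  graphs-complete (d ∷ ds) with graph-complete d | graphs-complete ds
  ... | B₁ , h₁ | B₂ , h₂ = B₁ ⊔ B₂ , λ { ρ xs (y ∷ ys) b refl refl B≤ →
          h₁ ρ xs y b refl refl (≤-trans (m≤m⊔n B₁ B₂) B≤) , h₂ ρ xs ys b refl refl (≤-trans (m≤n⊔m B₁ B₂) B≤) }

mutual
  ⇓-deterministic : ∀ {n} {f : Rec n} {X y z} → f ⟦ X ⟧⇓ y → f ⟦ X ⟧⇓ z → y ≡ z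
  ⇓-deterministic e-zero e-zero = refl
  ⇓-deterministic (e-succ _) (e-succ _) = refl
  ⇓-deterministic (e-proj _ _) (e-proj _ _) = refl
  ⇓-deterministic (e-comp ds d) (e-comp ds′ d′) with ⇓*-deterministic ds ds′
  ... | refl = ⇓-deterministic d d′
  ⇓-deterministic (e-prec0 d) (e-prec0 d′) = ⇓-deterministic d d′
  ⇓-deterministic (e-precS d e) (e-precS d′ e′) with ⇓-deterministic d d′
  ... | refl = ⇓-deterministic e e′
  ⇓-deterministic {y = y} {z} (e-mu d below) (e-mu d′ below′) with <-cmp y z
  ... | tri≈ _ y≡z _ = y≡z
  ... | tri< y<z _ _ = ⊥-elim (0≢1+n (⇓-deterministic d (proj₂ (below′ y y<z))))
  ... | tri> _ _ z<y = ⊥-elim (1+n≢0 (⇓-deterministic (proj₂ (below z z<y)) d′))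

  ⇓*-deterministic : ∀ {n j} {gs : Vec (Rec n) j} {X ys zs} → gs ⟦ X ⟧⇓* ys → gs ⟦ X ⟧⇓* zs → ys ≡ zs
  ⇓*-deterministic [] [] = refl
  ⇓*-deterministic (d ∷ ds) (d′ ∷ ds′) = cong₂ _∷_ (⇓-deterministic d d′) (⇓*-deterministic ds ds′)

-- Recursive computation of the diagonal

constR : ∀ {n} → ℕ → Rec n
constR zero    = comp zeroF []
constR (suc c) = comp succF (constR c ∷ [])

constR⇓ : ∀ {n} c {X : Vec ℕ n} → constR c ⟦ X ⟧⇓ c
constR⇓ zero    = e-comp [] e-zero
constR⇓ (suc c) = e-comp (constR⇓ c ∷ []) (e-succ c)

addR mulR pairR : Rec 2
addR  = prec (proj #0) (comp succF (proj #1 ∷ []))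
mulR  = prec (constR 0) (comp addR (proj #2 ∷ proj #1 ∷ []))
pairR = comp mulR (comp powR (proj #0 ∷ []) ∷ comp succ2* (proj #1 ∷ []) ∷ [])
  where
    powR succ2* : Rec 1
    powR   = prec (constR 1) (comp mulR (constR 2 ∷ proj #1 ∷ []))
    succ2* = comp addR (comp mulR (constR 2 ∷ proj #0 ∷ []) ∷ constR 1 ∷ [])

addR⇓ : ∀ m n → addR ⟦ m ∷ n ∷ [] ⟧⇓ (m + n)
addR⇓ zero    n = e-prec0 (e-proj _ _)
addR⇓ (suc m) n = e-precS (addR⇓ m n) (e-comp (e-proj _ _ ∷ []) (e-succ _))

mulR⇓ : ∀ m n → mulR ⟦ m ∷ n ∷ [] ⟧⇓ (m * n)
mulR⇓ zero    n = e-prec0 (constR⇓ 0)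
mulR⇓ (suc m) n = e-precS (mulR⇓ m n) (e-comp (e-proj _ _ ∷ e-proj _ _ ∷ []) (addR⇓ n (m * n)))

pairR⇓ : ∀ m n → pairR ⟦ m ∷ n ∷ [] ⟧⇓ pair m n
pairR⇓ m n = e-comp
  (e-comp (e-proj _ _ ∷ []) (powR⇓ m) ∷
   e-comp (e-proj _ _ ∷ [])
     (e-comp (e-comp (constR⇓ 2 ∷ e-proj _ _ ∷ []) (mulR⇓ 2 n) ∷ constR⇓ 1 ∷ []) (addR⇓ (2 * n) 1)) ∷ [])
  (mulR⇓ (2 ^ m) (2 * n + 1))
  where
    powR⇓ : ∀ m → _ ⟦ m ∷ [] ⟧⇓ (2 ^ m)
    powR⇓ zero    = e-prec0 (constR⇓ 1)
    powR⇓ (suc m) = e-precS (powR⇓ m) (e-comp (constR⇓ 2 ∷ e-proj _ _ ∷ []) (mulR⇓ 2 (2 ^ m)))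

-- The base value `2` is `pair 1 0`, the code of `zer`.
numCodeR : Rec 1
numCodeR = prec (constR 2) (comp pairR (constR 2 ∷ proj #1 ∷ []))

data PairExpr : Set where
  const      : ℕ → PairExpr
  arg numArg : PairExpr
  _,,_       : PairExpr → PairExpr → PairExpr

infixr 4 _,,_

compile : PairExpr → Rec 1
compile (const c) = constR c
compile arg       = proj #0
compile numArg    = numCodeR
compile (p ,, q)  = comp pairR (compile p ∷ compile q ∷ [])

-- Here `var 0` is the witness w, `var 1` the bounded variable x, and Φ is Φ(x , w).
diagBody : ℕ → Formula → Formula
diagBody n Φ = ¬′ ((var 0 ≼ num n) ∨′ ∃≤ 1 0 ((var 1 ≐ num n) ∧′ Φ))

-- The bounded quantifier puts `n` for `x` by an equation, so the code of the sentence arises from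
-- `n` and the code of `Φ` by pairing, without computing a substitution. The disjunct
-- `var 0 ≼ num n` covers small `w`, for which `x ≤ w` may not reach `n`.
diag : ℕ → Formula → Formula
diag n Φ = ∃′ 0 (diagBody n Φ)

var0 var1 : PairExpr
var0 = const 0 ,, const 0
var1 = const 0 ,, const 1

-- The code of `diag n Φ` with `arg` for the code of `Φ`. As `numArg` codes the numeral of the same
-- argument, evaluation at the code of `Φ` diagonalises.
diagExpr : PairExpr
diagExpr =
  const 9 ,, const 0 ,, const 5 ,,
    (const 7 ,, (const 1 ,, var0 ,, numArg) ,,
      const 9 ,, const 1 ,, const 6 ,, (const 1 ,, var1 ,, var0) ,,
        const 6 ,, (const 0 ,, var1 ,, numArg) ,, arg) ,,
    const 4 ,, const 0

-- The pairing function is kept abstract here: unfolding the powers of two in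
-- `pair` makes it infeasible to compare nested codes by computation.
module Coding (_∙_ : ℕ → ℕ → ℕ) where
  termCode : Term → ℕ
  termCode (var x) = 0 ∙ x
  termCode zer     = 1 ∙ 0
  termCode (S t)   = 2 ∙ termCode t

  formulaCode : Formula → ℕ
  formulaCode (t ≐ w)   = 0 ∙ (termCode t ∙ termCode w)
  formulaCode (t ≼ w)   = 1 ∙ (termCode t ∙ termCode w)
  formulaCode (A t w u) = 2 ∙ (termCode t ∙ (termCode w ∙ termCode u))
  formulaCode (M t w u) = 3 ∙ (termCode t ∙ (termCode w ∙ termCode u))
  formulaCode ⊥′        = 4 ∙ 0
  formulaCode (φ ⇒ ψ)   = 5 ∙ (formulaCode φ ∙ formulaCode ψ)
  formulaCode (φ ∧′ ψ)  = 6 ∙ (formulaCode φ ∙ formulaCode ψ)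
  formulaCode (φ ∨′ ψ)  = 7 ∙ (formulaCode φ ∙ formulaCode ψ)
  formulaCode (∀′ x φ)  = 8 ∙ (x ∙ formulaCode φ)
  formulaCode (∃′ x φ)  = 9 ∙ (x ∙ formulaCode φ)

  module _ (pairR⇓ : ∀ m n → pairR ⟦ m ∷ n ∷ [] ⟧⇓ (m ∙ n)) (zer⇓ : 2 ≡ 1 ∙ 0) where

    evalP : PairExpr → ℕ → ℕ
    evalP (const c) n = c
    evalP arg       n = n
    evalP numArg    n = termCode (num n)
    evalP (p ,, q)  n = evalP p n ∙ evalP q n

    numCodeR⇓ : ∀ n → numCodeR ⟦ n ∷ [] ⟧⇓ termCode (num n)
    numCodeR⇓ zero    = e-prec0 (subst (constR 2 ⟦ [] ⟧⇓_) zer⇓ (constR⇓ 2))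
    numCodeR⇓ (suc n) = e-precS (numCodeR⇓ n) (e-comp (constR⇓ 2 ∷ e-proj _ _ ∷ []) (pairR⇓ 2 (termCode (num n))))

    compile⇓ : ∀ p n → compile p ⟦ n ∷ [] ⟧⇓ evalP p n
    compile⇓ (const c) n = constR⇓ c
    compile⇓ arg       n = e-proj _ _
    compile⇓ numArg    n = numCodeR⇓ n
    compile⇓ (p ,, q)  n = e-comp (compile⇓ p n ∷ compile⇓ q n ∷ []) (pairR⇓ (evalP p n) (evalP q n))

    diagExpr⇓ : ∀ Φ → compile diagExpr ⟦ formulaCode Φ ∷ [] ⟧⇓ formulaCode (diag (formulaCode Φ) Φ)
    diagExpr⇓ Φ = compile⇓ diagExpr (formulaCode Φ)

termCode-pair : ∀ t → Coding.termCode pair t ≡ codeT t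
termCode-pair (var x) = refl
termCode-pair zer     = refl
termCode-pair (S t)   = cong (pair 2) (termCode-pair t)

formulaCode-pair : ∀ φ → Coding.formulaCode pair φ ≡ code φ
formulaCode-pair (t ≐ u)   = cong₂ (triple 0) (termCode-pair t) (termCode-pair u)
formulaCode-pair (t ≼ u)   = cong₂ (triple 1) (termCode-pair t) (termCode-pair u)
formulaCode-pair (A t u w) = cong₂ (triple 2) (termCode-pair t) (cong₂ pair (termCode-pair u) (termCode-pair w))
formulaCode-pair (M t u w) = cong₂ (triple 3) (termCode-pair t) (cong₂ pair (termCode-pair u) (termCode-pair w))
formulaCode-pair ⊥′        = refl
formulaCode-pair (φ ⇒ ψ)   = cong₂ (triple 5) (formulaCode-pair φ) (formulaCode-pair ψ)
formulaCode-pair (φ ∧′ ψ)  = cong₂ (triple 6) (formulaCode-pair φ) (formulaCode-pair ψ)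
formulaCode-pair (φ ∨′ ψ)  = cong₂ (triple 7) (formulaCode-pair φ) (formulaCode-pair ψ)
formulaCode-pair (∀′ x φ)  = cong (triple 8 x) (formulaCode-pair φ)
formulaCode-pair (∃′ x φ)  = cong (triple 9 x) (formulaCode-pair φ)

-- Undecidability

module Diagonal {T : Theory} (str : Strengthens T R∽) (h : Rec 1) where
  open Arithmetic str

  -- The variables are x and w, in this order.  In the left disjunct reindex replaces w by w′, so that
  -- instantiating x and w′ by numerals closes the formula and `decided` applies while w is arbitrary.
  Φᶠ : Fm 2
  Φᶠ = ∃ᶠ #1 (reindex (#0 ∷ #1 ∷ #0 ∷ []) (graph h (v #1 ∷ []) (lit 1) #0)) ∨ᶠ ¬ᶠ graph h (v #0 ∷ []) (lit 0) #1

  Φ : Formula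
  Φ = tr Φᶠ (var 1 ∷ var 0 ∷ [])

  -- Its translation at `var 0` computes to `diagBody n Φ`, which makes `tr-Δ₀` and `decided`
  -- available for the diagonal sentence.
  bodyᶠ : ℕ → Fm 1
  bodyᶠ n = ¬ᶠ (v #0 ≤ᶠ lit n ∨ᶠ ∃ᶠ #0 (v #0 ≈ lit n ∧ᶠ Φᶠ))

  diag-Σ₁ : ∀ n → Σ₁ (diag n Φ)
  diag-Σ₁ n = sigma 0 (tr-Δ₀ (bodyᶠ n) (s≤s z≤n ∷ []))

  diag-provable : ∀ n → h ⟦ n ∷ [] ⟧⇓ 0 → T ⊢ diag n Φ
  diag-provable n h⇓0 = exI (diagBody n Φ) 0 w
    (subst (T ⊢_) (sym (tr-subst (bodyᶠ n) (var 0 ∷ []) (num w) (s≤s z≤n)))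
      (provable (decided (bodyᶠ n) (w ∷ [])) holds))
    where
      B = proj₁ (graph-complete h⇓0)
      -- `w` exceeds `n`, falsifying `w ≤ n`, and reaches `B`, from where on `graph` certifies the
      -- value `0`.
      w = suc n ⊔ B
      holds : (w ∷ []) ⊩ bodyᶠ n
      holds (inj₁ w≤n) = <⇒≱ (m≤m⊔n (suc n) B) w≤n
      holds (inj₂ (.n , _ , refl , inj₁ (w′ , _ , h⇓1))) =
        0≢1+n (⇓-deterministic h⇓0 (graph-sound h _ _ _ _ h⇓1))
      holds (inj₂ (.n , _ , refl , inj₂ ¬h⇓0)) =
        ¬h⇓0 (proj₂ (graph-complete h⇓0) _ _ _ _ refl refl (m≤n⊔m (suc n) B))

  -- For arbitrary `w` the disjunction negated in `diagBody` is derived by totality at `n`; `r-as`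
  -- then refutes the body and `r-∃` the sentence.
  diag-refutable : ∀ n → h ⟦ n ∷ [] ⟧⇓ 1 → T ⊢ ¬′ (diag n Φ)
  diag-refutable n h⇓1 = r-∃ 0 (λ ()) (r-as ⊥′ (∨E (ax (ax-tot 0 n)) (ax-∨₁ _ _) (r-tr above (ax-∨₂ _ _))))
    where
      B = proj₁ (graph-complete h⇓1)
      σ = num n ∷ var 0 ∷ []

      below : T ⊢ var 0 ≼ num B ⇒ tr Φᶠ σ
      below = r-tr (≼-cases 0 B case) (ax-∨₂ _ _)
        where
          χ : Fm 2
          χ = ¬ᶠ graph h (v #0 ∷ []) (lit 0) #1
          case : ∀ i → i ≤ B → T ⊢ var 0 ≐ num i ⇒ tr χ σ
          case i _ = subst (λ t → T ⊢ var 0 ≐ num i ⇒ tr χ (t ∷ var 0 ∷ [])) (num-subst n _ 1)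
            -- Variable `0` is `w` itself, so variable `1` marks its place.
            (leibniz χ (num n ∷ var 1 ∷ []) i (s≤s (s≤s z≤n)) (s≤s z≤n) (λ ())
              (subst (λ t → T ⊢ tr χ (t ∷ num i ∷ [])) (sym (num-subst n _ 1))
                (provable (decided χ (n ∷ i ∷ []))
                  (λ h⇓0 → 0≢1+n (⇓-deterministic (graph-sound h _ _ _ _ h⇓0) h⇓1)))))

      Φ-holds : T ⊢ tr Φᶠ σ
      Φ-holds = ∨E (ax (ax-tot 0 B)) below (r-tr above-B (ax-∨₁ _ _))
        where
          ψ : Fm 3
          ψ = graph h (v #1 ∷ []) (lit 1) #0
          ψ-holds : T ⊢ tr ψ (num B ∷ num n ∷ num B ∷ [])
          ψ-holds = provable (decided ψ (B ∷ n ∷ B ∷ [])) (proj₂ (graph-complete h⇓1) _ _ _ _ refl refl ≤-refl)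
          matrix : Formula
          matrix = (var 2 ≼ var 0) ∧′ tr ψ (var 2 ∷ num n ∷ var 2 ∷ [])
          -- `B` is the witness for w′, and the hypothesis is its bound.
          above-B : T ⊢ num B ≼ var 0 ⇒ ∃′ 2 matrix
          above-B = r-tr (r-∧I (ax-id _) (r-wk _ ψ-holds))
            (subst (λ φ → T ⊢ (num B ≼ var 0) ∧′ φ ⇒ ∃′ 2 matrix)
              (trans (tr-subst ψ (var 2 ∷ num n ∷ var 2 ∷ []) (num B) ≤-refl)
                     (cong (λ t → tr ψ (num B ∷ t ∷ num B ∷ [])) (num-subst n (num B) 2)))
              (ax-∃ 2 matrix (num B) (num-substitutable B 2 matrix)))

      above : T ⊢ num n ≼ var 0 ⇒ ∃≤ 1 0 ((var 1 ≐ num n) ∧′ Φ)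
      above = r-tr (r-∧I (ax-id _) (r-wk _ (∧I (num-refl n) Φ-holds)))
        (subst (λ φ → T ⊢ φ ⇒ ∃≤ 1 0 ((var 1 ≐ num n) ∧′ Φ))
          (cong₂ (λ t ψ → (num n ≼ var 0) ∧′ ((num n ≐ t) ∧′ ψ))
            (num-subst n (num n) 1) (tr-subst Φᶠ (var 1 ∷ var 0 ∷ []) (num n) (s≤s (s≤s z≤n))))
          (ax-∃ 1 ((var 1 ≼ var 0) ∧′ ((var 1 ≐ num n) ∧′ Φ)) (num n) (num-substitutable n 1 ((var 1 ≼ var 0) ∧′ ((var 1 ≐ num n) ∧′ Φ)))))

  -- Value `1` of `h` at its own diagonal sentence makes that sentence both derived and refuted;
  -- value `0` makes it derivable against the claim. Leaving `n` existential keeps the coding out of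
  -- the argument.
  not-self-deciding : Σ₁-Consistent T →
    ¬ (∀ Φ → ∃ λ n → (h ⟦ n ∷ [] ⟧⇓ 1 × (T ⊢ diag n Φ)) ⊎ (h ⟦ n ∷ [] ⟧⇓ 0 × ¬ (T ⊢ diag n Φ)))
  not-self-deciding con decides with decides Φ
  ... | n , inj₁ (h⇓1 , ⊢G) = con (diag n Φ , diag-Σ₁ n , ⊢G , diag-refutable n h⇓1)
  ... | n , inj₂ (h⇓0 , ⊬G) = ⊬G (diag-provable n h⇓0)

strengthening⇒undecidable : ∀ {T} → Σ₁-Consistent T → Strengthens T R∽ → Undecidable T
strengthening⇒undecidable {T} con str (f , f-decides) =
  Diagonal.not-self-deciding str (comp f (compile diagExpr ∷ [])) con λ Φ →
    formulaCode Φ , Sum.map (Prod.map₁ (h⇓ Φ)) (Prod.map₁ (h⇓ Φ)) (f-decides′ (diag (formulaCode Φ) Φ))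
  where
    open Coding pair using (formulaCode; diagExpr⇓)
    -- The passage from `code` to `formulaCode` is an equation, which avoids unfolding `pair` on
    -- large codes.
    f-decides′ : ∀ φ → (f ⟦ formulaCode φ ∷ [] ⟧⇓ 1 × (T ⊢ φ)) ⊎ (f ⟦ formulaCode φ ∷ [] ⟧⇓ 0 × ¬ (T ⊢ φ))
    f-decides′ φ = subst (λ c → (f ⟦ c ∷ [] ⟧⇓ 1 × (T ⊢ φ)) ⊎ (f ⟦ c ∷ [] ⟧⇓ 0 × ¬ (T ⊢ φ)))
      (sym (formulaCode-pair φ)) (f-decides φ)
    h⇓ : ∀ Φ {y} → f ⟦ formulaCode (diag (formulaCode Φ) Φ) ∷ [] ⟧⇓ y →
         comp f (compile diagExpr ∷ []) ⟦ formulaCode Φ ∷ [] ⟧⇓ y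
    h⇓ Φ d = e-comp (diagExpr⇓ pairR⇓ refl Φ ∷ []) d

mainTheorem1 : Σ₁-Consistent R∽ × ((T : Theory) → Σ₁-Consistent T → Strengthens T R∽ → Undecidable T)
mainTheorem1 = R∽-Σ₁-consistent , λ T → strengthening⇒undecidable
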